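{- Let $\epsilon=o(W^{ -1})$, and denote $\mathcal B=W\log\left\lfloor\frac{1}{4W\epsilon}+1\right\rfloor$. Then Algorithm 3 (described in the context, run with $\upsilon=\lceil\log(\epsilon^{ -1}W)\rceil$ and $k=\left\lceil\frac1{2\epsilon-2^{ -\upsilon}}\right\rceil$) provides an $RW\epsilon$-additive approximation to Basic-Summing (with window size $W$ and integer elements in $\{0,1,\dots,R\}$) using $\mathcal B\cdot(1+o(1))$ bits of memory.
   Context: All logarithms are base 2; $W,R\ge1$ are integers, $\epsilon>0$ depends on $W$, and the $o(\cdot)$ notation is for $W\to\infty$. Basic-Summing: given a stream of integers in $\{0,1,\dots,R\}$ arriving one at a time, maintain the sum $S$ of the last $W$ elements (elements before the beginning of the stream are regarded as 0). An $RW\epsilon$-additive approximation means that for every input stream and at every time the value $\widehat S$ returned by Query satisfies $|\widehat S-S|\le RW\epsilon$. The memory of the algorithm is the number of bits used to store its variables. For $z\in[0,1]$, $\mathrm{Round}_{\upsilon}(z)$ denotes rounding of $z$ to the nearest value $\widetilde z$ such that $2^{\upsilon}\widetilde z$ is an integer. Algorithm 3. Variables: a fractional number $y$, integers $B,i$, and an array $b=(b_0,\dots,b_{W-1})$ of nonnegative integers, all initialized to $0$. Add(element $x$): do in order: (1) $x'=\mathrm{Round}_{\upsilon}\left(\frac xR\right)$; (2) $B\leftarrow B-b_i$; (3) $b_i\leftarrow\left\lfloor\frac{y+x'}{W/k}\right\rfloor$; (4) $y\leftarrow y+x'-b_i\cdot\frac Wk$; (5) $B\leftarrow B+b_i$;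 (6) $i\leftarrow i+1\bmod W$. Query: return $R\cdot\left(\frac Wk\cdot B+y-\frac W{2k}\right)$. Each arriving stream element is processed by one call of Add. Each cell of $b$ needs to represent a value in $\{0,1,\dots,\lfloor1+\frac kW\rfloor\}$; the remainder $y$ is a fractional number represented using $\upsilon$ bits; $i$ and $B$ are stored as binary integers. -}

module Defs where

open import Algebra.Structures using (IsCommutativeRing)
open import Algebra.Bundles using (CommutativeRing; Semiring)
import Algebra.Definitions.RawSemiring as RawSemiringDefs
open import Data.Fin using (Fin; toℕ)
open import Data.Integer as ℤ using (ℤ; +_; -[1+_])
open import Data.List using (List; foldl; map; reverse; sum; take)
open import Data.Nat as ℕ using (ℕ; NonZero)
open import Data.Nat.DivMod using (_mod_)
open import Data.Product using (_×_; ∃; ∃-syntax)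
open import Data.Sum using ([_,_]′)
open import Data.Vec using (Vec; lookup; replicate; _[_]≔_)
open import Function using (const)
open import Level using (Level; _⊔_)
open import Relation.Binary using (Rel; IsDecTotalOrder)
import Relation.Binary.Construct.NonStrictToStrict as NonStrictToStrict
open import Relation.Nullary using (¬_)

module Embeddings {c ℓ} (R : CommutativeRing c ℓ) where
  open CommutativeRing R
  open RawSemiringDefs (Semiring.rawSemiring semiring) renaming (_×_ to _×ₙ_)

  fromℕ : ℕ → Carrier
  fromℕ n = n ×ₙ 1#

  fromℤ : ℤ → Carrier
  fromℤ (+ n)    = fromℕ n
  fromℤ -[1+ n ] = - fromℕ (ℕ.suc n)

-- Archimedean ordered fields with a base-2 logarithm.  The classical real
-- numbers are an instance, so a statement about every such structure covers
-- real-valued parameters; completeness is not needed and not assumed.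
-- The laws determine ⌊_⌋, and log₂ on the positive elements, uniquely;
-- 0# ⁻¹ and log₂ of nonpositive elements are unspecified.
record RealField (c ℓ₁ ℓ₂ : Level) : Set (Level.suc (c ⊔ ℓ₁ ⊔ ℓ₂)) where
  infix  4 _≈_ _≤_
  infixl 6 _+_
  infixl 7 _*_
  infix  8 -_
  infix  9 _⁻¹
  field
    Carrier : Set c
    _≈_     : Rel Carrier ℓ₁
    _≤_     : Rel Carrier ℓ₂
    _+_ _*_ : Carrier → Carrier → Carrier
    -_      : Carrier → Carrier
    0# 1#   : Carrier
    _⁻¹     : Carrier → Carrier
    ⌊_⌋     : Carrier → ℤ
    log₂    : Carrier → Carrier

    isCommutativeRing : IsCommutativeRing _≈_ _+_ _*_ -_ 0# 1#
    isDecTotalOrder   : IsDecTotalOrder _≈_ _≤_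

  commutativeRing : CommutativeRing c ℓ₁
  commutativeRing = record { isCommutativeRing = isCommutativeRing }

  open CommutativeRing commutativeRing public using (semiring; _-_)
  open IsDecTotalOrder isDecTotalOrder public using (total)
  open NonStrictToStrict _≈_ _≤_ public using (_<_)
  open RawSemiringDefs (Semiring.rawSemiring semiring) public using (_^_)
  open Embeddings commutativeRing public

  infixl 7 _/_
  _/_ : Carrier → Carrier → Carrier
  x / y = x * y ⁻¹

  2# : Carrier
  2# = 1# + 1#

  field
    0≉1         : ¬ (0# ≈ 1#)
    ⁻¹-inverse  : ∀ {x} → ¬ (x ≈ 0#) → x * x ⁻¹ ≈ 1#
    +-monoˡ-≤   : ∀ {x y} z → x ≤ y → x + z ≤ y + z
    *-nonneg    : ∀ {x y} → 0# ≤ x → 0# ≤ y → 0# ≤ x * y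
    ⌊⌋-lower    : ∀ x → fromℤ ⌊ x ⌋ ≤ x
    ⌊⌋-upper    : ∀ x → x < fromℤ ⌊ x ⌋ + 1#
    log₂-cong   : ∀ {x y} → 0# < x → x ≈ y → log₂ x ≈ log₂ y
    log₂-mono-< : ∀ {x y} → 0# < x → x < y → log₂ x < log₂ y
    log₂-*      : ∀ {x y} → 0# < x → 0# < y → log₂ (x * y) ≈ log₂ x + log₂ y
    log₂-2      : log₂ 2# ≈ 1#

  ⌈_⌉ : Carrier → ℤ
  ⌈ x ⌉ = ℤ.- ⌊ - x ⌋

  ∣_∣ : Carrier → Carrier
  ∣ x ∣ = [ const x , const (- x) ]′ (total 0# x)

  infix 9 2^_
  2^_ : ℤ → Carrier
  2^ (+ n)    = 2# ^ n
  2^ -[1+ n ] = (2# ^ ℕ.suc n) ⁻¹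

module Summing {c ℓ₁ ℓ₂} (ℝ : RealField c ℓ₁ ℓ₂) where
  open RealField ℝ

  -- Asymptotics for W → ∞

  Eventually : ∀ {p} → (ℕ → Set p) → Set p
  Eventually P = ∃[ N ] (∀ W → N ℕ.≤ W → P W)

  infix 4 _=o_ _∼_·[1+o1]

  _=o_ : (f g : ℕ → Carrier) → Set (c ⊔ ℓ₁ ⊔ ℓ₂)
  f =o g = ∀ η → 0# < η → Eventually (λ W → ∣ f W ∣ ≤ η * ∣ g W ∣)

  _∼_·[1+o1] : (f g : ℕ → Carrier) → Set (c ⊔ ℓ₁ ⊔ ℓ₂)
  f ∼ g ·[1+o1] =
    ∃ λ δ → (δ =o const 1#) × Eventually (λ W → f W ≈ g W * (1# + δ W))

  -- The way ties are broken is left open.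
  record IsRounding (round : ℤ → Carrier → Carrier) : Set (c ⊔ ℓ₁ ⊔ ℓ₂) where
    field
      onGrid  : ∀ υ z → 0# ≤ z → z ≤ 1# → ∃ λ m → 2^ υ * round υ z ≈ fromℤ m
      nearest : ∀ υ z → 0# ≤ z → z ≤ 1# →
                ∀ z′ m → 2^ υ * z′ ≈ fromℤ m → ∣ round υ z - z ∣ ≤ ∣ z′ - z ∣

  -- Basic-Summing.  A list holds the elements seen so far, oldest first.

  Stream : ℕ → Set
  Stream R = List (Fin (ℕ.suc R))

  windowSum : ∀ W {R} → Stream R → ℕ
  windowSum W xs = sum (take W (map toℕ (reverse xs)))

  IsAdditiveApproximation : ∀ W R → Carrier → (Stream R → Carrier) → Set ℓ₂
  IsAdditiveApproximation W R e answer =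
    ∀ xs → ∣ answer xs - fromℕ (windowSum W xs) ∣ ≤ e

  record State (W : ℕ) : Set c where
    field
      y : Carrier
      B : ℤ
      i : Fin W
      b : Vec ℤ W

  module Algorithm (round : ℤ → Carrier → Carrier)
                   (W R : ℕ) .{{_ : NonZero W}} (υ k : ℤ) where

    W/k : Carrier
    W/k = fromℕ W / fromℤ k

    init : State W
    init = record { y = 0# ; B = + 0 ; i = 0 mod W ; b = replicate W (+ 0) }

    add : State W → Fin (ℕ.suc R) → State W
    add s x = record
      { y = (y + x′) - fromℤ bᵢ * W/k
      ; B = (B ℤ.- lookup b i) ℤ.+ bᵢ
      ; i = ℕ.suc (toℕ i) mod W
      ; b = b [ i ]≔ bᵢ
      }
      where
      open State s
      x′ : Carrier
      x′ = round υ (fromℕ (toℕ x) / fromℕ R)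
      bᵢ : ℤ
      bᵢ = ⌊ (y + x′) / W/k ⌋

    query : State W → Carrier
    query s = fromℕ R * ((W/k * fromℤ B + y) - fromℕ W / (2# * fromℤ k))
      where open State s

    run : Stream R → State W
    run = foldl add init

  module Parameters (ε : ℕ → Carrier) where

    υ : ℕ → ℤ
    υ W = ⌈ log₂ (ε W ⁻¹ * fromℕ W) ⌉

    k : ℕ → ℤ
    k W = ⌈ 1# / (2# * ε W - 2^ (ℤ.- υ W)) ⌉

    ℬ : ℕ → Carrier
    ℬ W = fromℕ W * log₂ (fromℤ ⌊ 1# / (fromℕ 4 * fromℕ W * ε W) + 1# ⌋)

    maxCell : ℕ → ℤ
    maxCell W = ⌊ 1# + fromℤ (k W) / fromℕ W ⌋

    -- Bits needed to tell n values apart.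
    bits : ℤ → ℤ
    bits n = ⌈ log₂ (fromℤ n) ⌉

    -- The variables y, b, i and B, in this order.
    memory : ℕ → ℤ
    memory W = υ W
         ℤ.+ + W ℤ.* bits (maxCell W ℤ.+ + 1)
         ℤ.+ bits (+ W)
         ℤ.+ bits (+ W ℤ.* maxCell W ℤ.+ + 1)

    -- As W/k need not be a multiple of 2^ (- υ), the exact y is in general
    -- not determined by υ bits.  It is a multiple of 1 / (2^ υ * k) in
    -- [0 , W/k), hence takes at most W * 2^ υ values, and bits (+ W) further
    -- bits suffice to hold it without loss.
    losslessMemory : ℕ → ℤ
    losslessMemory W = memory W ℤ.+ bits (+ W)

    -- The contents of the variables are within the ranges for which
    -- memory and losslessMemory account (for i this is its type).
    record Fits (W : ℕ) (s : State W) : Set (c ⊔ ℓ₁ ⊔ ℓ₂) where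
      open State s
      field
        cell-lower : ∀ j → + 0 ℤ.≤ lookup b j
        cell-upper : ∀ j → lookup b j ℤ.≤ maxCell W
        B-lower    : + 0 ℤ.≤ B
        B-upper    : B ℤ.≤ + W ℤ.* maxCell W
        y-lower    : 0# ≤ y
        y-upper    : y < 1#
        y-exact    : ∃ λ n → (y * (2^ (υ W) * fromℤ (k W)) ≈ fromℕ n)
                           × (fromℕ n < fromℕ W * 2^ (υ W))

{-# OPTIONS --safe #-}
module Submission where

-- Why the theorem is true.  Every Add splits the remainder plus the rounded
-- element as y + x′ = b · W/k + y′ with an integer b and 0 ≤ y′ < W/k.  Over
-- the last W steps these equations telescope: W/k · B + y is the sum of the
-- rounded elements of the window plus the remainder at its beginning
-- (total-written, telescope).  Subtracting W/(2k) centres that remainder, so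
-- it contributes at most W/(2k); rounding contributes at most half of the grid
-- step u = 2^(- υ) per element.  The choice of k gives 1 ≤ k (2ε - u), which makes
-- the total R (W u / 2 + W / (2k)) at most R W ε (additive-error).  This
-- needs only u ≤ ε and holds for every W.
--
-- If 2 W ε ≤ 1, then W ≤ k and 0 ≤ υ.  Hence y < W/k ≤ 1, every rounded element
-- is at most 1, and a written value is at most (y + x′) · k/W ≤ 1 + k/W (cell≤).
-- Each step changes y by an integer combination of 2^(- υ) and W/k, so that
-- y · 2^ υ · k stays a natural number below W · 2^ υ (remainder-exact).
--
-- For the memory put t = 1 / (4 W ε), T = ⌊t + 1⌋ and L = log T, so that
-- ℬ = W L.  From 1 / (2ε) ≤ k ≤ 1/ε + 1 the largest cell value M satisfies
-- T ≤ M and M + 1 ≤ 8 T, hence a cell takes between L and L + 4 bits.  As soon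
-- as 0 ≤ υ, the remaining terms of the lossless memory are nonnegative; they
-- add up to at most 2 L + 5 log W + 9.  With log W ≤ W both amounts of memory
-- lie between W L and W L + 18 W + 2 L (ℬ≤memory, losslessMemory≤).  As W ε
-- tends to 0, L tends to infinity, and the excess is eventually at most η W L
-- for every η > 0.

open import Algebra.Bundles using (CommutativeRing)
import Algebra.Properties.Ring as RingProperties
import Algebra.Properties.Semiring.Mult as Mult
import Algebra.Properties.Semiring.Mult.TCOptimised as MultTC
import Algebra.Solver.Ring as RingSolver
open import Algebra.Solver.Ring.AlmostCommutativeRing
  using (_-Raw-AlmostCommutative⟶_; fromCommutativeRing)
open import Data.Empty using (⊥-elim)
open import Data.Fin using (Fin; toℕ)
import Data.Fin.Properties as Fin
open import Data.Integer as ℤ using (ℤ; +_; -[1+_]; _⊖_)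
import Data.Integer.Properties as ℤ
import Data.Integer.Solver as ℤ-Solver
open import Data.List as List using (List; []; _∷_; foldr; take; drop; length; reverse)
import Data.List.Properties as List
open import Data.List.Relation.Unary.All using (All; []; _∷_)
open import Data.Maybe using (map)
open import Data.Nat as ℕ using (ℕ; zero; suc; NonZero)
import Data.Nat.DivMod as ℕ
open import Data.Nat.DivMod using (_mod_; _%_)
open import Data.Nat.ListAction using (sum)
import Data.Nat.Properties as ℕ
open import Data.Product using (_×_; _,_; ∃; proj₁; proj₂)
open import Data.Sign using (Sign)
open import Data.Sum using (inj₁; inj₂)
open import Data.Vec using (lookup)
import Data.Vec.Properties as Vec
open import Defs
open import Function using (flip)
open import Relation.Binary using (IsDecTotalOrder; Poset)
import Relation.Binary.Construct.NonStrictToStrict as NonStrictToStrict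
open import Relation.Binary.PropositionalEquality as ≡ using (_≡_; _≢_; module ≡-Reasoning)
import Relation.Binary.Reasoning.PartialOrder as PosetReasoning
import Relation.Binary.Reasoning.Setoid as SetoidReasoning
open import Relation.Nullary using (¬_; yes; no)
open import Relation.Nullary.Decidable using (dec⇒maybe)

-- The integers inside a commutative ring

module IntegerEmbedding {c ℓ} (R : CommutativeRing c ℓ) where
  open CommutativeRing R
  open Embeddings R
  open Mult semiring using (×-homo-+; ×1-homo-*)
  open MultTC semiring using (×ᵤ≈×) renaming (_×_ to _×′_)
  open RingProperties ring
  open SetoidReasoning setoid

  fromℕ-+ : ∀ m n → fromℕ (m ℕ.+ n) ≈ fromℕ m + fromℕ n
  fromℕ-+ = ×-homo-+ 1#

  fromℕ-* : ∀ m n → fromℕ (m ℕ.* n) ≈ fromℕ m * fromℕ n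
  fromℕ-* = ×1-homo-*

  fromℤ-neg : ∀ a → fromℤ (ℤ.- a) ≈ - fromℤ a
  fromℤ-neg (+ zero)  = sym -0#≈0#
  fromℤ-neg (+ suc n) = refl
  fromℤ-neg -[1+ n ]  = sym (-‿involutive _)

  fromℤ-⊖ : ∀ m n → fromℤ (m ⊖ n) ≈ fromℕ m - fromℕ n
  fromℤ-⊖ m       zero    = sym (trans (+-congˡ -0#≈0#) (+-identityʳ _))
  fromℤ-⊖ zero    (suc n) = sym (+-identityˡ _)
  fromℤ-⊖ (suc m) (suc n) = begin
    fromℤ (suc m ⊖ suc n)              ≡⟨ ≡.cong fromℤ (ℤ.[1+m]⊖[1+n]≡m⊖n m n) ⟩
    fromℤ (m ⊖ n)                      ≈⟨ fromℤ-⊖ m n ⟩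
    fromℕ m - fromℕ n                  ≈⟨ +-congʳ (xyx⁻¹≈y 1# (fromℕ m)) ⟨
    ((1# + fromℕ m) - 1#) - fromℕ n    ≈⟨ +-assoc _ _ _ ⟩
    (1# + fromℕ m) + (- 1# - fromℕ n)  ≈⟨ +-congˡ (-‿+-comm 1# (fromℕ n)) ⟩
    fromℕ (suc m) - fromℕ (suc n)      ∎

  fromℤ-+ : ∀ a b → fromℤ (a ℤ.+ b) ≈ fromℤ a + fromℤ b
  fromℤ-+ (+ m)    (+ n)    = fromℕ-+ m n
  fromℤ-+ (+ m)    -[1+ n ] = fromℤ-⊖ m (suc n)
  fromℤ-+ -[1+ m ] (+ n)    = trans (fromℤ-⊖ n (suc m)) (+-comm _ _)
  fromℤ-+ -[1+ m ] -[1+ n ] = begin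
    - fromℕ (suc (suc (m ℕ.+ n)))        ≡⟨ ≡.cong (λ s → - fromℕ (suc s)) (ℕ.+-suc m n) ⟨
    - fromℕ (suc m ℕ.+ suc n)            ≈⟨ -‿cong (fromℕ-+ (suc m) (suc n)) ⟩
    - (fromℕ (suc m) + fromℕ (suc n))    ≈⟨ -‿+-comm _ _ ⟨
    - fromℕ (suc m) - fromℕ (suc n)      ∎

  fromℤ-- : ∀ a b → fromℤ (a ℤ.- b) ≈ fromℤ a - fromℤ b
  fromℤ-- a b = trans (fromℤ-+ a (ℤ.- b)) (+-congˡ (fromℤ-neg b))

  private
    fromℤ-neg◃ : ∀ n → fromℤ (Sign.- ℤ.◃ n) ≈ - fromℕ n
    fromℤ-neg◃ n = trans (reflexive (≡.cong fromℤ (ℤ.-◃n≡-n n))) (fromℤ-neg (+ n))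

  fromℤ-* : ∀ a b → fromℤ (a ℤ.* b) ≈ fromℤ a * fromℤ b
  fromℤ-* (+ m)    (+ n)    =
    trans (reflexive (≡.cong fromℤ (ℤ.+◃n≡+n (m ℕ.* n)))) (fromℕ-* m n)
  fromℤ-* (+ m)    -[1+ n ] = begin
    fromℤ (Sign.- ℤ.◃ (m ℕ.* suc n))  ≈⟨ fromℤ-neg◃ (m ℕ.* suc n) ⟩
    - fromℕ (m ℕ.* suc n)             ≈⟨ -‿cong (fromℕ-* m (suc n)) ⟩
    - (fromℕ m * fromℕ (suc n))       ≈⟨ -‿distribʳ-* _ _ ⟩
    fromℕ m * - fromℕ (suc n)         ∎
  fromℤ-* -[1+ m ] (+ n)    = begin
    fromℤ (Sign.- ℤ.◃ (suc m ℕ.* n))  ≈⟨ fromℤ-neg◃ (suc m ℕ.* n) ⟩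
    - fromℕ (suc m ℕ.* n)             ≈⟨ -‿cong (fromℕ-* (suc m) n) ⟩
    - (fromℕ (suc m) * fromℕ n)       ≈⟨ -‿distribˡ-* _ _ ⟩
    - fromℕ (suc m) * fromℕ n         ∎
  fromℤ-* -[1+ m ] -[1+ n ] = begin
    fromℕ (suc m ℕ.* suc n)             ≈⟨ fromℕ-* (suc m) (suc n) ⟩
    fromℕ (suc m) * fromℕ (suc n)       ≈⟨ -‿involutive _ ⟨
    - - (fromℕ (suc m) * fromℕ (suc n)) ≈⟨ -‿cong (-‿distribˡ-* _ _) ⟩
    - (- fromℕ (suc m) * fromℕ (suc n)) ≈⟨ -‿distribʳ-* _ _ ⟩
    - fromℕ (suc m) * - fromℕ (suc n)   ∎

  -- The same embedding, with values on numerals that are definitionally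
  -- 0#, 1#, 1# + 1#, and so on.
  ⟦_⟧ : ℤ → Carrier
  ⟦ + n ⟧      = n ×′ 1#
  ⟦ -[1+ n ] ⟧ = - (suc n ×′ 1#)

  fromℤ≈⟦⟧ : ∀ a → fromℤ a ≈ ⟦ a ⟧
  fromℤ≈⟦⟧ (+ n)    = ×ᵤ≈× n 1#
  fromℤ≈⟦⟧ -[1+ n ] = -‿cong (×ᵤ≈× (suc n) 1#)

  private
    ⟦⟧-homo₂ : (_•_ : ℤ → ℤ → ℤ) (_∘_ : Carrier → Carrier → Carrier) →
               (∀ {x x′ y y′} → x ≈ x′ → y ≈ y′ → x ∘ y ≈ x′ ∘ y′) →
               (∀ a b → fromℤ (a • b) ≈ fromℤ a ∘ fromℤ b) →
               ∀ a b → ⟦ a • b ⟧ ≈ ⟦ a ⟧ ∘ ⟦ b ⟧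
    ⟦⟧-homo₂ _•_ _ ∘-cong homo a b =
      trans (sym (fromℤ≈⟦⟧ (a • b))) (trans (homo a b) (∘-cong (fromℤ≈⟦⟧ a) (fromℤ≈⟦⟧ b)))

    morphism : CommutativeRing.rawRing ℤ.+-*-commutativeRing
                 -Raw-AlmostCommutative⟶ fromCommutativeRing R
    morphism = record
      { ⟦_⟧    = ⟦_⟧
      ; +-homo = ⟦⟧-homo₂ ℤ._+_ _+_ +-cong fromℤ-+
      ; *-homo = ⟦⟧-homo₂ ℤ._*_ _*_ *-cong fromℤ-*
      ; -‿homo = λ a → trans (sym (fromℤ≈⟦⟧ (ℤ.- a))) (trans (fromℤ-neg a) (-‿cong (fromℤ≈⟦⟧ a)))
      ; 0-homo = refl
      ; 1-homo = refl
      }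

  -- The ring solver with integer coefficients; deciding their equality lets
  -- it cancel terms.
  open RingSolver (CommutativeRing.rawRing ℤ.+-*-commutativeRing)
    (fromCommutativeRing R) morphism
    (λ a b → map (λ a≡b → reflexive (≡.cong ⟦_⟧ a≡b)) (dec⇒maybe (a ℤ.≟ b)))
    public using (solve; con; _:+_; _:*_; _:-_; :-_; _:=_)

-- Ordered fields with floor and logarithm

module OrderedField {c ℓ₁ ℓ₂} (ℝ : RealField c ℓ₁ ℓ₂) where
  open RealField ℝ
  open CommutativeRing commutativeRing public using
    ( refl; sym; trans; reflexive; +-cong; +-congˡ; +-congʳ; *-cong; *-congˡ; *-congʳ; -‿cong
    ; *-comm; *-assoc; *-identityˡ; *-identityʳ; +-identityˡ; +-identityʳ; zeroˡ; zeroʳ)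
  open IsDecTotalOrder isDecTotalOrder public
    using (_≟_; _≤?_; antisym; ≤-respˡ-≈; ≤-respʳ-≈; isPartialOrder)
    renaming (refl to ≤-refl; trans to ≤-trans; reflexive to ≤-reflexive)
  open IntegerEmbedding commutativeRing public

  poset : Poset c ℓ₁ ℓ₂
  poset = record { isPartialOrder = isPartialOrder }

  open PosetReasoning poset
  private module Strict = NonStrictToStrict _≈_ _≤_

  ≰⇒> : ∀ {x y} → ¬ x ≤ y → y < x
  ≰⇒> = Strict.≰⇒> sym ≤-reflexive total

  <⇒≱ : ∀ {x y} → x < y → ¬ y ≤ x
  <⇒≱ = Strict.<⇒≱ antisym

  <-≤-trans : ∀ {x y z} → x < y → y ≤ z → x < z
  <-≤-trans = Strict.<-≤-trans sym ≤-trans antisym ≤-respʳ-≈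

  ≤-<-trans : ∀ {x y z} → x ≤ y → y < z → x < z
  ≤-<-trans = Strict.≤-<-trans ≤-trans antisym ≤-respˡ-≈

  -- Inequalities are proved by exhibiting the difference of the two sides as
  -- an expression in nonnegative quantities; the ring solver checks the
  -- exhibited identity.
  x≤y⇒0≤y-x : ∀ {x y} → x ≤ y → 0# ≤ y - x
  x≤y⇒0≤y-x {x} {y} x≤y = begin
    0#     ≈⟨ solve 1 (λ x → con (+ 0) := x :- x) refl x ⟩
    x - x  ≤⟨ +-monoˡ-≤ (- x) x≤y ⟩
    y - x  ∎

  ≤-by-difference : ∀ {x y d} → 0# ≤ d → y - x ≈ d → x ≤ y
  ≤-by-difference {x} {y} {d} 0≤d y-x≈d = begin
    x          ≈⟨ +-identityˡ x ⟨
    0# + x     ≤⟨ +-monoˡ-≤ x 0≤d ⟩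
    d + x      ≈⟨ +-congʳ y-x≈d ⟨
    y - x + x  ≈⟨ solve 2 (λ x y → y :- x :+ x := y) refl x y ⟩
    y          ∎

  +-mono-≤ : ∀ {x y u v} → x ≤ y → u ≤ v → x + u ≤ y + v
  +-mono-≤ {x} {y} {u} {v} x≤y u≤v = begin
    x + u  ≤⟨ +-monoˡ-≤ u x≤y ⟩
    y + u  ≈⟨ solve 2 (λ y u → y :+ u := u :+ y) refl y u ⟩
    u + y  ≤⟨ +-monoˡ-≤ y u≤v ⟩
    v + y  ≈⟨ solve 2 (λ y u → y :+ u := u :+ y) refl v y ⟩
    y + v  ∎

  +-monoʳ-≤ : ∀ {x y} z → x ≤ y → z + x ≤ z + y
  +-monoʳ-≤ z = +-mono-≤ ≤-refl

  +-nonneg : ∀ {x y} → 0# ≤ x → 0# ≤ y → 0# ≤ x + y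
  +-nonneg 0≤x 0≤y = ≤-respˡ-≈ (+-identityˡ 0#) (+-mono-≤ 0≤x 0≤y)

  neg-mono-≤ : ∀ {x y} → x ≤ y → - y ≤ - x
  neg-mono-≤ {x} {y} x≤y = ≤-by-difference (x≤y⇒0≤y-x x≤y)
    (solve 2 (λ x y → :- x :- :- y := y :- x) refl x y)

  *-monoˡ-≤ : ∀ {x y z} → 0# ≤ z → x ≤ y → z * x ≤ z * y
  *-monoˡ-≤ {x} {y} {z} 0≤z x≤y = ≤-by-difference (*-nonneg 0≤z (x≤y⇒0≤y-x x≤y))
    (solve 3 (λ x y z → z :* y :- z :* x := z :* (y :- x)) refl x y z)

  *-monoʳ-≤ : ∀ {x y z} → 0# ≤ z → x ≤ y → x * z ≤ y * z
  *-monoʳ-≤ 0≤z x≤y = ≤-respˡ-≈ (*-comm _ _) (≤-respʳ-≈ (*-comm _ _) (*-monoˡ-≤ 0≤z x≤y))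

  0<⇒≉0 : ∀ {x} → 0# < x → ¬ x ≈ 0#
  0<⇒≉0 (_ , 0≉x) x≈0 = 0≉x (sym x≈0)

  ⁻¹-cancelʳ : ∀ {x} → 0# < x → x * x ⁻¹ ≈ 1#
  ⁻¹-cancelʳ 0<x = ⁻¹-inverse (0<⇒≉0 0<x)

  0≤1 : 0# ≤ 1#
  0≤1 with total 0# 1#
  ... | inj₁ 0≤1 = 0≤1
  ... | inj₂ 1≤0 = ≤-respʳ-≈ (solve 0 (:- con (+ 1) :* :- con (+ 1) := con (+ 1)) refl)
    (*-nonneg 0≤-1 0≤-1)
    where
    0≤-1 : 0# ≤ - 1#
    0≤-1 = ≤-respʳ-≈ (+-identityˡ _) (x≤y⇒0≤y-x 1≤0)

  0<1 : 0# < 1#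
  0<1 = 0≤1 , 0≉1

  -- A product can only vanish if a factor does.
  *-pos : ∀ {x y} → 0# < x → 0# < y → 0# < x * y
  *-pos {x} {y} 0<x 0<y = *-nonneg (proj₁ 0<x) (proj₁ 0<y) , λ 0≈xy →
    proj₂ 0<y (begin-equality
      0#                ≈⟨ zeroˡ _ ⟨
      0# * x ⁻¹         ≈⟨ *-congʳ 0≈xy ⟩
      x * y * x ⁻¹      ≈⟨ solve 3 (λ x y x⁻¹ → x :* y :* x⁻¹ := x :* x⁻¹ :* y) refl x y (x ⁻¹) ⟩
      x * x ⁻¹ * y      ≈⟨ *-congʳ (⁻¹-cancelʳ 0<x) ⟩
      1# * y            ≈⟨ *-identityˡ y ⟩
      y                 ∎)

  ⁻¹-pos : ∀ {x} → 0# < x → 0# < x ⁻¹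
  ⁻¹-pos {x} 0<x = ≰⇒> λ x⁻¹≤0 → <⇒≱ 0<1 (begin
    1#         ≈⟨ ⁻¹-cancelʳ 0<x ⟨
    x * x ⁻¹   ≤⟨ *-monoˡ-≤ (proj₁ 0<x) x⁻¹≤0 ⟩
    x * 0#     ≈⟨ zeroʳ x ⟩
    0#         ∎)

  /-cancelʳ : ∀ x {y} → 0# < y → x / y * y ≈ x
  /-cancelʳ x {y} 0<y = begin-equality
    x * y ⁻¹ * y    ≈⟨ solve 3 (λ x y y⁻¹ → x :* y⁻¹ :* y := x :* (y :* y⁻¹)) refl x y (y ⁻¹) ⟩
    x * (y * y ⁻¹)  ≈⟨ *-congˡ (⁻¹-cancelʳ 0<y) ⟩
    x * 1#          ≈⟨ *-identityʳ x ⟩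
    x               ∎

  *-cancelʳ-≤ : ∀ {x y z} → 0# < z → x * z ≤ y * z → x ≤ y
  *-cancelʳ-≤ {x} {y} {z} 0<z xz≤yz = begin
    x             ≈⟨ cancel x ⟨
    x * z / z     ≤⟨ *-monoʳ-≤ (proj₁ (⁻¹-pos 0<z)) xz≤yz ⟩
    y * z / z     ≈⟨ cancel y ⟩
    y             ∎
    where
    cancel : ∀ x → x * z / z ≈ x
    cancel x = trans (*-assoc _ _ _) (trans (*-congˡ (⁻¹-cancelʳ 0<z)) (*-identityʳ x))

  *-cancelʳ-≈ : ∀ {x y z} → 0# < z → x * z ≈ y * z → x ≈ y
  *-cancelʳ-≈ 0<z xz≈yz = antisym (*-cancelʳ-≤ 0<z (≤-reflexive xz≈yz))
                                  (*-cancelʳ-≤ 0<z (≤-reflexive (sym xz≈yz)))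

  *-monoʳ-< : ∀ {x y z} → 0# < z → x < y → x * z < y * z
  *-monoʳ-< 0<z x<y = ≰⇒> λ yz≤xz → <⇒≱ x<y (*-cancelʳ-≤ 0<z yz≤xz)

  ≤-/ : ∀ {x y z} → 0# < z → x * z ≤ y → x ≤ y / z
  ≤-/ 0<z xz≤y = *-cancelʳ-≤ 0<z (≤-respʳ-≈ (sym (/-cancelʳ _ 0<z)) xz≤y)

  /-≤ : ∀ {x y z} → 0# < z → x ≤ y * z → x / z ≤ y
  /-≤ 0<z x≤yz = *-cancelʳ-≤ 0<z (≤-respˡ-≈ (sym (/-cancelʳ _ 0<z)) x≤yz)

  -- Absolute value

  x≤∣x∣ : ∀ x → x ≤ ∣ x ∣
  x≤∣x∣ x with total 0# x
  ... | inj₁ 0≤x = ≤-refl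
  ... | inj₂ x≤0 = ≤-by-difference (+-nonneg (x≤y⇒0≤y-x x≤0) (x≤y⇒0≤y-x x≤0))
    (solve 1 (λ x → :- x :- x := (con (+ 0) :- x) :+ (con (+ 0) :- x)) refl x)

  -x≤∣x∣ : ∀ x → - x ≤ ∣ x ∣
  -x≤∣x∣ x with total 0# x
  ... | inj₁ 0≤x = ≤-by-difference (+-nonneg 0≤x 0≤x)
    (solve 1 (λ x → x :- :- x := x :+ x) refl x)
  ... | inj₂ x≤0 = ≤-refl

  ∣∣-least : ∀ {x e} → x ≤ e → - x ≤ e → ∣ x ∣ ≤ e
  ∣∣-least {x} x≤e -x≤e with total 0# x
  ... | inj₁ 0≤x = x≤e
  ... | inj₂ x≤0 = -x≤e

  nonneg⇒∣∣≈ : ∀ {x} → 0# ≤ x → ∣ x ∣ ≈ x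
  nonneg⇒∣∣≈ {x} 0≤x = antisym
    (∣∣-least ≤-refl (≤-trans (neg-mono-≤ 0≤x)
      (≤-respˡ-≈ (solve 0 (con (+ 0) := :- con (+ 0)) refl) 0≤x)))
    (x≤∣x∣ x)

  ∣∣-resp-≈ : ∀ {x y} → x ≈ y → ∣ x ∣ ≈ ∣ y ∣
  ∣∣-resp-≈ x≈y = antisym (below x≈y) (below (sym x≈y))
    where
    below : ∀ {x y} → x ≈ y → ∣ x ∣ ≤ ∣ y ∣
    below {x} {y} x≈y = ∣∣-least (≤-respˡ-≈ (sym x≈y) (x≤∣x∣ y))
                                 (≤-respˡ-≈ (-‿cong (sym x≈y)) (-x≤∣x∣ y))

  ∣x+y∣≤∣x∣+∣y∣ : ∀ x y → ∣ x + y ∣ ≤ ∣ x ∣ + ∣ y ∣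
  ∣x+y∣≤∣x∣+∣y∣ x y = ∣∣-least (+-mono-≤ (x≤∣x∣ x) (x≤∣x∣ y))
    (≤-respˡ-≈ (solve 2 (λ x y → :- x :+ :- y := :- (x :+ y)) refl x y)
      (+-mono-≤ (-x≤∣x∣ x) (-x≤∣x∣ y)))

  -- Embedded integers

  0≤fromℕ : ∀ n → 0# ≤ fromℕ n
  0≤fromℕ zero    = ≤-refl
  0≤fromℕ (suc n) = +-nonneg 0≤1 (0≤fromℕ n)

  fromℤ-mono-≤ : ∀ {a b} → a ℤ.≤ b → fromℤ a ≤ fromℤ b
  fromℤ-mono-≤ {a} {b} a≤b = ≤-by-difference (nonneg (ℤ.i≤j⇒0≤j-i a≤b))
    (sym (fromℤ-- b a))
    where
    nonneg : ∀ {d} → + 0 ℤ.≤ d → 0# ≤ fromℤ d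
    nonneg {+ n} _ = 0≤fromℕ n

  fromℕ-mono-≤ : ∀ {m n} → m ℕ.≤ n → fromℕ m ≤ fromℕ n
  fromℕ-mono-≤ m≤n = fromℤ-mono-≤ (ℤ.+≤+ m≤n)

  fromℕ-1 : fromℕ 1 ≈ 1#
  fromℕ-1 = +-identityʳ 1#

  fromℕ-pos : ∀ n → .{{NonZero n}} → 0# < fromℕ n
  fromℕ-pos (suc n) = <-≤-trans 0<1 (≤-respˡ-≈ fromℕ-1 (fromℕ-mono-≤ {1} {suc n} (ℕ.s≤s ℕ.z≤n)))

  fromℤ-suc : ∀ a → fromℤ (a ℤ.+ + 1) ≈ fromℤ a + 1#
  fromℤ-suc a = trans (fromℤ-+ a (+ 1)) (+-congˡ fromℕ-1)

  -- Between consecutive embedded integers there is no further one.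
  fromℤ<+1⇒≤ : ∀ {a b} → fromℤ a < fromℤ b + 1# → a ℤ.≤ b
  fromℤ<+1⇒≤ {a} {b} a<b+1 = ℤ.≮⇒≥ λ b<a → <⇒≱ a<b+1 (begin
    fromℤ b + 1#        ≈⟨ fromℤ-suc b ⟨
    fromℤ (b ℤ.+ + 1)   ≤⟨ fromℤ-mono-≤ (≡.subst (ℤ._≤ a) (ℤ.+-comm (+ 1) b) (ℤ.i<j⇒suc[i]≤j b<a)) ⟩
    fromℤ a             ∎)

  x<x+1 : ∀ x → x < x + 1#
  x<x+1 x = ≰⇒> λ x+1≤x → <⇒≱ 0<1 (≤-by-difference (x≤y⇒0≤y-x x+1≤x)
    (solve 1 (λ x → con (+ 0) :- con (+ 1) := x :- (x :+ con (+ 1))) refl x))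

  fromℤ-cancel-≤ : ∀ {a b} → fromℤ a ≤ fromℤ b → a ℤ.≤ b
  fromℤ-cancel-≤ a≤b = fromℤ<+1⇒≤ (≤-<-trans a≤b (x<x+1 _))

  -- With ⌊⌋-lower: ⌊ x ⌋ is the greatest integer not above x.
  ⌊⌋-greatest : ∀ {a x} → fromℤ a ≤ x → a ℤ.≤ ⌊ x ⌋
  ⌊⌋-greatest a≤x = fromℤ<+1⇒≤ (≤-<-trans a≤x (⌊⌋-upper _))

  fromℤ⌈⌉ : ∀ x → fromℤ ⌈ x ⌉ ≈ - fromℤ ⌊ - x ⌋
  fromℤ⌈⌉ x = fromℤ-neg ⌊ - x ⌋

  ⌈⌉-upper : ∀ x → x ≤ fromℤ ⌈ x ⌉
  ⌈⌉-upper x = begin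
    x                   ≈⟨ solve 1 (λ x → x := :- :- x) refl x ⟩
    - - x               ≤⟨ neg-mono-≤ (⌊⌋-lower (- x)) ⟩
    - fromℤ ⌊ - x ⌋     ≈⟨ fromℤ⌈⌉ x ⟨
    fromℤ ⌈ x ⌉         ∎

  ⌈⌉-lower : ∀ x → fromℤ ⌈ x ⌉ ≤ x + 1#
  ⌈⌉-lower x = ≤-by-difference (x≤y⇒0≤y-x (proj₁ (⌊⌋-upper (- x))))
    (trans (+-congˡ (-‿cong (fromℤ⌈⌉ x)))
      (solve 2 (λ x n → x :+ con (+ 1) :- :- n := (n :+ con (+ 1)) :- :- x) refl x (fromℤ ⌊ - x ⌋)))

  0≤⌈⌉ : ∀ {x} → 0# ≤ x → + 0 ℤ.≤ ⌈ x ⌉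
  0≤⌈⌉ 0≤x = fromℤ-cancel-≤ (≤-trans 0≤x (⌈⌉-upper _))

  -- Powers of two and logarithms

  0<2 : 0# < 2#
  0<2 = <-≤-trans 0<1 (≤-respˡ-≈ (+-identityʳ 1#) (+-monoʳ-≤ 1# 0≤1))

  2^ⁿ-pos : ∀ n → 0# < 2# ^ n
  2^ⁿ-pos zero    = 0<1
  2^ⁿ-pos (suc n) = *-pos 0<2 (2^ⁿ-pos n)

  2^-pos : ∀ a → 0# < 2^ a
  2^-pos (+ n)    = 2^ⁿ-pos n
  2^-pos -[1+ n ] = ⁻¹-pos (2^ⁿ-pos (suc n))

  2^-inverse : ∀ a → 2^ (ℤ.- a) * 2^ a ≈ 1#
  2^-inverse (+ zero)  = *-identityʳ 1#
  2^-inverse (+ suc n) = trans (*-comm _ _) (⁻¹-cancelʳ (2^ⁿ-pos (suc n)))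
  2^-inverse -[1+ n ]  = ⁻¹-cancelʳ (2^ⁿ-pos (suc n))

  log₂-mono-≤ : ∀ {x y} → 0# < x → x ≤ y → log₂ x ≤ log₂ y
  log₂-mono-≤ {x} {y} 0<x x≤y with x ≟ y
  ... | yes x≈y = ≤-reflexive (log₂-cong 0<x x≈y)
  ... | no  x≉y = proj₁ (log₂-mono-< 0<x (x≤y , x≉y))

  log₂-cancel-≤ : ∀ {x y} → 0# < y → log₂ x ≤ log₂ y → x ≤ y
  log₂-cancel-≤ {x} {y} 0<y lx≤ly with x ≤? y
  ... | yes x≤y = x≤y
  ... | no  x≰y = ⊥-elim (<⇒≱ (log₂-mono-< 0<y (≰⇒> x≰y)) lx≤ly)

  log₂-1 : log₂ 1# ≈ 0#
  log₂-1 = begin-equality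
    log₂ 1#                      ≈⟨ solve 1 (λ l → l := l :+ l :- l) refl (log₂ 1#) ⟩
    log₂ 1# + log₂ 1# - log₂ 1#  ≈⟨ +-congʳ (log₂-* 0<1 0<1) ⟨
    log₂ (1# * 1#) - log₂ 1#     ≈⟨ +-congʳ (log₂-cong (*-pos 0<1 0<1) (*-identityʳ 1#)) ⟩
    log₂ 1# - log₂ 1#            ≈⟨ solve 1 (λ l → l :- l := con (+ 0)) refl (log₂ 1#) ⟩
    0#                           ∎

  0≤log₂ : ∀ {x} → 1# ≤ x → 0# ≤ log₂ x
  0≤log₂ 1≤x = ≤-respˡ-≈ log₂-1 (log₂-mono-≤ 0<1 1≤x)

  log₂-2^ⁿ : ∀ n → log₂ (2# ^ n) ≈ fromℕ n
  log₂-2^ⁿ zero    = log₂-1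
  log₂-2^ⁿ (suc n) = trans (log₂-* 0<2 (2^ⁿ-pos n)) (+-cong log₂-2 (log₂-2^ⁿ n))

  log₂-2^ : ∀ a → log₂ (2^ a) ≈ fromℤ a
  log₂-2^ (+ n)    = log₂-2^ⁿ n
  log₂-2^ -[1+ n ] = begin-equality
    log₂ ((2# ^ suc n) ⁻¹)
      ≈⟨ solve 2 (λ a b → b := a :+ b :- a) refl (log₂ (2# ^ suc n)) _ ⟩
    log₂ (2# ^ suc n) + log₂ ((2# ^ suc n) ⁻¹) - log₂ (2# ^ suc n)
                                                      ≈⟨ +-congʳ (log₂-* p (⁻¹-pos p)) ⟨
    log₂ (2# ^ suc n / 2# ^ suc n) - log₂ (2# ^ suc n)
                                                      ≈⟨ +-congʳ (log₂-cong (*-pos p (⁻¹-pos p)) (⁻¹-cancelʳ p)) ⟩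
    log₂ 1# - log₂ (2# ^ suc n)                       ≈⟨ +-cong log₂-1 (-‿cong (log₂-2^ⁿ (suc n))) ⟩
    0# - fromℕ (suc n)                                ≈⟨ +-identityˡ _ ⟩
    - fromℕ (suc n)                                   ∎
    where
    p : 0# < 2# ^ suc n
    p = 2^ⁿ-pos (suc n)

  fromℕ≤2^ : ∀ n → fromℕ n ≤ 2# ^ n
  fromℕ≤2^ zero    = 0≤1
  fromℕ≤2^ (suc n) = begin
    1# + fromℕ n     ≤⟨ +-mono-≤ (1≤2^ n) (fromℕ≤2^ n) ⟩
    2# ^ n + 2# ^ n  ≈⟨ solve 1 (λ p → p :+ p := con (+ 2) :* p) refl (2# ^ n) ⟩
    2# * 2# ^ n      ∎
    where
    1≤2^ : ∀ n → 1# ≤ 2# ^ n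
    1≤2^ zero    = ≤-refl
    1≤2^ (suc n) = ≤-by-difference (+-nonneg (x≤y⇒0≤y-x (1≤2^ n)) (proj₁ (2^ⁿ-pos n)))
      (solve 1 (λ p → con (+ 2) :* p :- con (+ 1) := (p :- con (+ 1)) :+ p) refl (2# ^ n))

  log₂-fromℕ≤ : ∀ n → .{{NonZero n}} → log₂ (fromℕ n) ≤ fromℕ n
  log₂-fromℕ≤ n = ≤-respʳ-≈ (log₂-2^ⁿ n) (log₂-mono-≤ (fromℕ-pos n) (fromℕ≤2^ n))

  2^ⁿ-integral : ∀ n → 2^ (+ n) ≈ fromℕ (2 ℕ.^ n)
  2^ⁿ-integral zero    = sym fromℕ-1
  2^ⁿ-integral (suc n) = trans (*-cong (+-congˡ (sym fromℕ-1)) (2^ⁿ-integral n))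
                               (sym (fromℕ-* 2 (2 ℕ.^ n)))

  2^-integral : ∀ {a} → + 0 ℤ.≤ a → ∃ λ b → 2^ a ≈ fromℤ b
  2^-integral {+ n} _ = + (2 ℕ.^ n) , 2^ⁿ-integral n

  -- Every element is below some natural number.
  archimedean : ∀ x → x ≤ fromℕ ℤ.∣ ⌈ x ⌉ ∣
  archimedean x = ≤-trans (⌈⌉-upper x) (fromℤ-mono-≤ (i≤+∣i∣ ⌈ x ⌉))
    where
    i≤+∣i∣ : ∀ a → a ℤ.≤ + ℤ.∣ a ∣
    i≤+∣i∣ (+ n)    = ℤ.≤-refl
    i≤+∣i∣ -[1+ n ] = ℤ.-≤+

-- Finite sums of integers

sumℤ : List ℤ → ℤ
sumℤ = foldr ℤ._+_ (+ 0)

-- The element at the given position, 0 beyond the end of the list.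
entry : List ℤ → ℕ → ℤ
entry []      _       = + 0
entry (a ∷ l) zero    = a
entry (a ∷ l) (suc d) = entry l d

sumℤ-take-suc : ∀ n l → sumℤ (take (suc n) l) ≡ sumℤ (take n l) ℤ.+ entry l n
sumℤ-take-suc zero    []      = ≡.refl
sumℤ-take-suc (suc n) []      = ≡.refl
sumℤ-take-suc zero    (a ∷ l) = ℤ.+-comm a (+ 0)
sumℤ-take-suc (suc n) (a ∷ l) =
  ≡.trans (≡.cong (ℤ._+_ a) (sumℤ-take-suc n l)) (≡.sym (ℤ.+-assoc a _ _))

-- Sliding the window: the newest element a enters, the oldest leaves.
sumℤ-slide : ∀ n a l →
  (sumℤ (take (suc n) l) ℤ.- entry l n) ℤ.+ a ≡ sumℤ (take (suc n) (a ∷ l))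
sumℤ-slide n a l = begin
  (sumℤ (take (suc n) l) ℤ.- entry l n) ℤ.+ a
    ≡⟨ ≡.cong (λ s → (s ℤ.- entry l n) ℤ.+ a) (sumℤ-take-suc n l) ⟩
  ((sumℤ (take n l) ℤ.+ entry l n) ℤ.- entry l n) ℤ.+ a
    ≡⟨ solve 3 (λ s e a → ((s :+ e) :- e) :+ a := a :+ s) ≡.refl (sumℤ (take n l)) (entry l n) a ⟩
  a ℤ.+ sumℤ (take n l) ∎
  where
  open ≡-Reasoning
  open ℤ-Solver.+-*-Solver

sumℤ-take-nonneg : ∀ n {l} → All (+ 0 ℤ.≤_) l → + 0 ℤ.≤ sumℤ (take n l)
sumℤ-take-nonneg zero    _        = ℤ.≤-refl
sumℤ-take-nonneg (suc n) []       = ℤ.≤-refl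
sumℤ-take-nonneg (suc n) (p ∷ ps) = ℤ.+-mono-≤ p (sumℤ-take-nonneg n ps)

sumℤ-take-≤ : ∀ {M} → + 0 ℤ.≤ M → ∀ n {l} → All (ℤ._≤ M) l →
              sumℤ (take n l) ℤ.≤ + n ℤ.* M
sumℤ-take-≤ {M} 0≤M zero    _  = ℤ.≤-reflexive (≡.sym (ℤ.*-zeroˡ M))
sumℤ-take-≤ {M} 0≤M (suc n) ps =
  ℤ.≤-trans (step ps) (ℤ.≤-reflexive (≡.sym (ℤ.suc-* (+ n) M)))
  where
  step : ∀ {l} → All (ℤ._≤ M) l → sumℤ (take (suc n) l) ℤ.≤ M ℤ.+ + n ℤ.* M
  step []       = ℤ.+-mono-≤ 0≤M
    (≡.subst (λ l → sumℤ l ℤ.≤ + n ℤ.* M) (List.take-[] n) (sumℤ-take-≤ 0≤M n []))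
  step (p ∷ ps) = ℤ.+-mono-≤ p (sumℤ-take-≤ 0≤M n ps)

-- Residues modulo W as indices

module _ (W : ℕ) .{{_ : NonZero W}} where

  toℕ-mod : ∀ m → toℕ (m mod W) ≡ m % W
  toℕ-mod m = Fin.toℕ-fromℕ< (ℕ.m%n<n m W)

  mod-cong : ∀ {m n} → m % W ≡ n % W → m mod W ≡ n mod W
  mod-cong {m} {n} eq =
    Fin.toℕ-injective (≡.trans (toℕ-mod m) (≡.trans eq (≡.sym (toℕ-mod n))))

  suc-mod : ∀ m → suc (toℕ (m mod W)) mod W ≡ suc m mod W
  suc-mod m = mod-cong (begin
    suc (toℕ (m mod W)) % W        ≡⟨ ≡.cong (λ r → suc r % W) (toℕ-mod m) ⟩
    (1 ℕ.+ m % W) % W              ≡⟨ ℕ.%-distribˡ-+ 1 (m % W) W ⟩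
    (1 % W ℕ.+ m % W % W) % W      ≡⟨ ≡.cong (λ r → (1 % W ℕ.+ r) % W) (ℕ.m%n%n≡m%n m W) ⟩
    (1 % W ℕ.+ m % W) % W          ≡⟨ ℕ.%-distribˡ-+ 1 m W ⟨
    suc m % W                      ∎)
    where open ≡-Reasoning

  -- With r = m % W, the residue of m + s is r + s or r + s - W, and neither
  -- of them is r.
  +-mod-≢ : ∀ m {s} → 0 ℕ.< s → s ℕ.< W → (m ℕ.+ s) mod W ≢ m mod W
  +-mod-≢ m {s} 0<s s<W eq = absurd (r ℕ.+ s ℕ.<? W)
    where
    r : ℕ
    r = m % W
    r+s%W≡r : (r ℕ.+ s) % W ≡ r
    r+s%W≡r = begin
      (r ℕ.+ s) % W          ≡⟨ ≡.cong (λ t → (r ℕ.+ t) % W) (ℕ.m<n⇒m%n≡m s<W) ⟨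
      (r ℕ.+ s % W) % W      ≡⟨ ℕ.%-distribˡ-+ m s W ⟨
      (m ℕ.+ s) % W          ≡⟨ toℕ-mod (m ℕ.+ s) ⟨
      toℕ ((m ℕ.+ s) mod W)  ≡⟨ ≡.cong toℕ eq ⟩
      toℕ (m mod W)          ≡⟨ toℕ-mod m ⟩
      r                      ∎
      where open ≡-Reasoning
    absurd : _ → _
    absurd (yes r+s<W) = ℕ.<⇒≢ (ℕ.m<m+n r 0<s)
      (≡.sym (≡.trans (≡.sym (ℕ.m<n⇒m%n≡m r+s<W)) r+s%W≡r))
    absurd (no r+s≮W) = ℕ.<⇒≢ s<W (ℕ.+-cancelˡ-≡ r s W (begin
      r ℕ.+ s                ≡⟨ ℕ.m∸n+n≡m W≤r+s ⟨
      (r ℕ.+ s ℕ.∸ W) ℕ.+ W  ≡⟨ ≡.cong (ℕ._+ W) r+s∸W≡r ⟩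
      r ℕ.+ W                ∎))
      where
      open ≡-Reasoning
      W≤r+s : W ℕ.≤ r ℕ.+ s
      W≤r+s = ℕ.≮⇒≥ r+s≮W
      r+s∸W<W : r ℕ.+ s ℕ.∸ W ℕ.< W
      r+s∸W<W = ℕ.+-cancelʳ-< W _ _ (≡.subst (ℕ._< W ℕ.+ W) (≡.sym (ℕ.m∸n+n≡m W≤r+s))
        (ℕ.+-mono-< (ℕ.m%n<n m W) s<W))
      r+s∸W≡r : r ℕ.+ s ℕ.∸ W ≡ r
      r+s∸W≡r = begin
        r ℕ.+ s ℕ.∸ W        ≡⟨ ℕ.m<n⇒m%n≡m r+s∸W<W ⟨
        (r ℕ.+ s ℕ.∸ W) % W  ≡⟨ ℕ.m≤n⇒[n∸m]%m≡n%m W≤r+s ⟩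
        (r ℕ.+ s) % W        ≡⟨ r+s%W≡r ⟩
        r                    ∎

-- Rounding to the grid of multiples of 2^ (- υ)

module Rounding {c ℓ₁ ℓ₂} (ℝ : RealField c ℓ₁ ℓ₂)
  (round : ℤ → RealField.Carrier ℝ → RealField.Carrier ℝ)
  (isRounding : Summing.IsRounding ℝ round) where

  open RealField ℝ
  open Summing ℝ
  open OrderedField ℝ
  open IsRounding isRounding
  open PosetReasoning poset

  module _ (υ : ℤ) {z : Carrier} (0≤z : 0# ≤ z) (z≤1 : z ≤ 1#) where

    -- Both neighbouring grid points compete with the rounded value, and
    -- their distances to z add up to the grid step.
    round-error : 2# * ∣ round υ z - z ∣ ≤ 2^ (ℤ.- υ)
    round-error = begin
      2# * e                         ≈⟨ solve 1 (λ e → con (+ 2) :* e := e :+ e) refl e ⟩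
      e + e                          ≤⟨ +-mono-≤ e≤below e≤above ⟩
      (z - m * u) + ((m + 1#) * u - z)
                                       ≈⟨ solve 3 (λ z m u → (z :- m :* u) :+ ((m :+ con (+ 1)) :* u :- z)
                                            := u) refl
                                            z m u ⟩
      u                              ∎
      where
      e u m : Carrier
      e = ∣ round υ z - z ∣
      u = 2^ (ℤ.- υ)
      m = fromℤ ⌊ 2^ υ * z ⌋
      uP≈1 : u * 2^ υ ≈ 1#
      uP≈1 = 2^-inverse υ
      z≈ : 2^ υ * z * u ≈ z
      z≈ = trans (solve 3 (λ p z u → p :* z :* u := z :* (u :* p)) refl (2^ υ) z u)
                 (trans (*-congˡ uP≈1) (*-identityʳ z))
      onGrid′ : ∀ a → 2^ υ * (a * u) ≈ a
      onGrid′ a = trans (solve 3 (λ p a u → p :* (a :* u) := a :* (u :* p)) refl (2^ υ) a u)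
                        (trans (*-congˡ uP≈1) (*-identityʳ a))
      below : m * u ≤ z
      below = ≤-respʳ-≈ z≈ (*-monoʳ-≤ (proj₁ (2^-pos (ℤ.- υ))) (⌊⌋-lower _))
      above : z ≤ (m + 1#) * u
      above = ≤-respˡ-≈ z≈ (*-monoʳ-≤ (proj₁ (2^-pos (ℤ.- υ))) (proj₁ (⌊⌋-upper _)))
      e≤below : e ≤ z - m * u
      e≤below = ≤-trans (nearest υ z 0≤z z≤1 (m * u) ⌊ 2^ υ * z ⌋ (onGrid′ m)) (∣∣-least
        (≤-by-difference (+-nonneg (x≤y⇒0≤y-x below) (x≤y⇒0≤y-x below))
          (solve 2 (λ z a → (z :- a) :- (a :- z) := (z :- a) :+ (z :- a)) refl z (m * u)))
        (≤-reflexive (solve 2 (λ z a → :- (a :- z) := z :- a) refl z (m * u))))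
      e≤above : e ≤ (m + 1#) * u - z
      e≤above = ≤-trans
        (nearest υ z 0≤z z≤1 ((m + 1#) * u) (⌊ 2^ υ * z ⌋ ℤ.+ + 1)
          (trans (onGrid′ (m + 1#)) (sym (fromℤ-suc ⌊ 2^ υ * z ⌋))))
        (≤-reflexive (nonneg⇒∣∣≈ (x≤y⇒0≤y-x above)))

    -- 0 is a grid point at distance z from z.
    0≤round : 0# ≤ round υ z
    0≤round = ≤-by-difference (x≤y⇒0≤y-x (begin
      - (round υ z - z)  ≤⟨ -x≤∣x∣ _ ⟩
      ∣ round υ z - z ∣  ≤⟨ nearest υ z 0≤z z≤1 0# (+ 0) (zeroʳ _) ⟩
      ∣ 0# - z ∣         ≤⟨ ∣∣-least (≤-by-difference (+-nonneg 0≤z 0≤z)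
                              (solve 1 (λ z → z :- (con (+ 0) :- z) := z :+ z) refl z))
                            (≤-reflexive (solve 1 (λ z → :- (con (+ 0) :- z) := z) refl z)) ⟩
      z                  ∎))
      (solve 2 (λ r z → r :- con (+ 0) := z :- :- (r :- z)) refl (round υ z) z)

  -- For 0 ≤ υ the number 1 lies on the grid.
  round≤1 : ∀ {υ} → + 0 ℤ.≤ υ → ∀ {z} → 0# ≤ z → z ≤ 1# → round υ z ≤ 1#
  round≤1 {+ n} _ {z} 0≤z z≤1 = ≤-by-difference (x≤y⇒0≤y-x (begin
    round (+ n) z - z      ≤⟨ x≤∣x∣ _ ⟩
    ∣ round (+ n) z - z ∣  ≤⟨ nearest (+ n) z 0≤z z≤1 1# (+ (2 ℕ.^ n))
                                (trans (*-identityʳ _) (2^ⁿ-integral n)) ⟩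
    ∣ 1# - z ∣             ≈⟨ nonneg⇒∣∣≈ (x≤y⇒0≤y-x z≤1) ⟩
    1# - z                 ∎))
    (solve 2 (λ r z → con (+ 1) :- r := (con (+ 1) :- z) :- (r :- z)) refl (round (+ n) z) z)

-- Runs of the algorithm, its accuracy and the ranges of its variables

module Trace {c ℓ₁ ℓ₂} (ℝ : RealField c ℓ₁ ℓ₂)
  (round : ℤ → RealField.Carrier ℝ → RealField.Carrier ℝ)
  (isRounding : Summing.IsRounding ℝ round)
  (W R : ℕ) .{{W≢0 : NonZero W}} .{{R≢0 : NonZero R}} (υ k : ℤ) where

  open RealField ℝ
  open Summing ℝ
  open OrderedField ℝ
  open IsRounding isRounding using (onGrid)
  open Rounding ℝ round isRounding
  open Algorithm round W R υ k

  -- The elements seen so far, newest first: adding an element is _∷_ and the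
  -- window is a prefix.
  History : Set
  History = List (Fin (suc R))

  -- The state after the history.
  after : History → State W
  after = foldr (flip add) init

  run≡after : ∀ xs → run xs ≡ after (reverse xs)
  run≡after xs = ≡.sym (List.reverse-foldr (flip add) init xs)

  0<ℝW : 0# < fromℕ W
  0<ℝW = fromℕ-pos W

  0<ℝR : 0# < fromℕ R
  0<ℝR = fromℕ-pos R

  -- The element x / R of the unit interval.
  scaled : Fin (suc R) → Carrier
  scaled x = fromℕ (toℕ x) / fromℕ R

  0≤scaled : ∀ x → 0# ≤ scaled x
  0≤scaled x = *-nonneg (0≤fromℕ (toℕ x)) (proj₁ (⁻¹-pos 0<ℝR))

  scaled≤1 : ∀ x → scaled x ≤ 1#
  scaled≤1 x = /-≤ 0<ℝR (≤-respʳ-≈ (sym (*-identityˡ _)) (fromℕ-mono-≤ (Fin.toℕ≤pred[n] x)))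

  -- The value x′ that Add computes for the element x.
  rounded : Fin (suc R) → Carrier
  rounded x = round υ (scaled x)

  sumℝ : List Carrier → Carrier
  sumℝ = foldr _+_ 0#

  -- The variable y after the given history.
  remainder : History → Carrier
  remainder h = State.y (after h)

  -- The value that Add writes into b when x arrives after the history h.
  cell : History → Fin (suc R) → ℤ
  cell h x = ⌊ (remainder h + rounded x) / W/k ⌋

  -- All values written into b, newest first, including overwritten ones.
  written : History → List ℤ
  written []      = []
  written (x ∷ h) = cell h x ∷ written h

  index : ∀ h → State.i (after h) ≡ length h mod W
  index []      = ≡.refl
  index (x ∷ h) = ≡.trans (≡.cong (λ i → suc (toℕ i) mod W) (index h)) (suc-mod W (length h))

  -- Reading the buffer from the next position to be overwritten onwards gives
  -- the last W written values, oldest first.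
  buffer : ∀ h e d → suc (e ℕ.+ d) ≡ W →
           lookup (State.b (after h)) ((length h ℕ.+ e) mod W) ≡ entry (written h) d
  buffer []      e d       _  = Vec.lookup-replicate (e mod W) (+ 0)
  buffer (x ∷ h) e zero    eq =
    ≡.trans (≡.cong (lookup (State.b (after (x ∷ h)))) position)
            (Vec.lookup∘update (State.i (after h)) (State.b (after h)) (cell h x))
    where
    position : (suc (length h) ℕ.+ e) mod W ≡ State.i (after h)
    position = ≡.trans (mod-cong W (begin
      (suc (length h) ℕ.+ e) % W  ≡⟨ ≡.cong (_% W) (ℕ.+-suc (length h) e) ⟨
      (length h ℕ.+ suc e) % W    ≡⟨ ≡.cong (λ s → (length h ℕ.+ s) % W)
                                       (≡.trans (≡.cong suc (≡.sym (ℕ.+-identityʳ e))) eq) ⟩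
      (length h ℕ.+ W) % W        ≡⟨ ℕ.[m+n]%n≡m%n (length h) W ⟩
      length h % W                ∎)) (≡.sym (index h))
      where open ≡-Reasoning
  buffer (x ∷ h) e (suc d) eq = begin
    lookup (State.b (after (x ∷ h))) ((suc (length h) ℕ.+ e) mod W)
      ≡⟨ ≡.cong (λ m → lookup (State.b (after (x ∷ h))) (m mod W)) (ℕ.+-suc (length h) e) ⟨
    lookup (State.b (after (x ∷ h))) ((length h ℕ.+ suc e) mod W)
      ≡⟨ Vec.lookup∘update′
           (λ p → +-mod-≢ W (length h) ℕ.z<s e+1<W (≡.trans p (index h)))
           (State.b (after h)) (cell h x) ⟩
    lookup (State.b (after h)) ((length h ℕ.+ suc e) mod W)
      ≡⟨ buffer h (suc e) d (≡.trans (≡.cong suc (≡.sym (ℕ.+-suc e d))) eq) ⟩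
    entry (written h) d ∎
    where
    open ≡-Reasoning
    e+1<W : suc e ℕ.< W
    e+1<W = ≡.subst (suc e ℕ.<_) eq (ℕ.s<s (ℕ.m<m+n e ℕ.z<s))

  -- B is the sum of the last W written values, because the value that Add
  -- subtracts was written W steps earlier, or is an initial 0.
  total-written : ∀ h → State.B (after h) ≡ sumℤ (take W (written h))
  total-written []      = ≡.cong sumℤ (≡.sym (List.take-[] W))
  total-written (x ∷ h) = begin
    (State.B (after h) ℤ.- lookup (State.b (after h)) (State.i (after h))) ℤ.+ cell h x
      ≡⟨ ≡.cong₂ (λ B c → (B ℤ.- c) ℤ.+ cell h x) (total-written h) oldest ⟩
    (sumℤ (take W (written h)) ℤ.- entry (written h) (ℕ.pred W)) ℤ.+ cell h x
      ≡⟨ ≡.cong (λ n → (sumℤ (take n (written h)) ℤ.- entry (written h) (ℕ.pred W)) ℤ.+ cell h x)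
           (ℕ.suc-pred W) ⟨
    (sumℤ (take (suc (ℕ.pred W)) (written h)) ℤ.- entry (written h) (ℕ.pred W)) ℤ.+ cell h x
      ≡⟨ sumℤ-slide (ℕ.pred W) (cell h x) (written h) ⟩
    sumℤ (take (suc (ℕ.pred W)) (cell h x ∷ written h))
      ≡⟨ ≡.cong (λ n → sumℤ (take n (written (x ∷ h)))) (ℕ.suc-pred W) ⟩
    sumℤ (take W (written (x ∷ h))) ∎
    where
    open ≡-Reasoning
    oldest : lookup (State.b (after h)) (State.i (after h)) ≡ entry (written h) (ℕ.pred W)
    oldest = ≡.trans
      (≡.cong (lookup (State.b (after h)))
        (≡.trans (index h) (≡.cong (_mod W) (≡.sym (ℕ.+-identityʳ (length h))))))
      (buffer h 0 (ℕ.pred W) (ℕ.suc-pred W))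

  open PosetReasoning poset

  -- What the last n steps wrote, plus the current remainder, accounts for the
  -- last n rounded elements plus the remainder before them.
  telescope : ∀ n h → W/k * fromℤ (sumℤ (take n (written h))) + remainder h
                    ≈ sumℝ (take n (List.map rounded h)) + remainder (drop n h)
  telescope zero    h       = +-congʳ (zeroʳ W/k)
  telescope (suc n) []      = +-congʳ (zeroʳ W/k)
  telescope (suc n) (x ∷ h) = begin-equality
    W/k * fromℤ (cell h x ℤ.+ s) + (remainder h + rounded x - fromℤ (cell h x) * W/k)
      ≈⟨ +-congʳ (*-congˡ (fromℤ-+ (cell h x) s)) ⟩
    W/k * (fromℤ (cell h x) + fromℤ s) + (remainder h + rounded x - fromℤ (cell h x) * W/k)
      ≈⟨ solve 5 (λ q c s y r → q :* (c :+ s) :+ (y :+ r :- c :* q) := r :+ (q :* s :+ y)) refl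
           W/k (fromℤ (cell h x)) (fromℤ s) (remainder h) (rounded x) ⟩
    rounded x + (W/k * fromℤ s + remainder h)
      ≈⟨ +-congˡ (telescope n h) ⟩
    rounded x + (sumℝ (take n (List.map rounded h)) + remainder (drop n h))
      ≈⟨ solve 3 (λ a b c → a :+ (b :+ c) := a :+ b :+ c) refl _ _ _ ⟩
    rounded x + sumℝ (take n (List.map rounded h)) + remainder (drop n h) ∎
    where
    s : ℤ
    s = sumℤ (take n (written h))

  -- Each element contributes at most half a grid step.
  rounding-error : ∀ n h →
    2# * ∣ sumℝ (take n (List.map rounded h)) - fromℕ (sum (take n (List.map toℕ h))) / fromℕ R ∣
      ≤ fromℕ n * 2^ (ℤ.- υ)
  rounding-error zero    h  = ≤-reflexive (none (2^ (ℤ.- υ)))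
    where
    none : ∀ u → 2# * ∣ 0# - 0# / fromℕ R ∣ ≈ 0# * u
    none u = trans
      (*-congˡ (trans
        (∣∣-resp-≈ (solve 1 (λ r → con (+ 0) :- con (+ 0) :* r := con (+ 0)) refl (fromℕ R ⁻¹)))
        (nonneg⇒∣∣≈ ≤-refl)))
      (trans (zeroʳ 2#) (sym (zeroˡ u)))
  rounding-error (suc n) [] = begin
    2# * ∣ 0# - 0# / fromℕ R ∣  ≤⟨ rounding-error 0 [] ⟩
    0# * 2^ (ℤ.- υ)             ≤⟨ *-monoʳ-≤ (proj₁ (2^-pos (ℤ.- υ))) (0≤fromℕ (suc n)) ⟩
    fromℕ (suc n) * 2^ (ℤ.- υ)  ∎
  rounding-error (suc n) (x ∷ h) = begin
    2# * ∣ rounded x + X - fromℕ (toℕ x ℕ.+ S) / fromℕ R ∣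
      ≈⟨ *-congˡ (∣∣-resp-≈ (begin-equality
           rounded x + X - fromℕ (toℕ x ℕ.+ S) / fromℕ R
             ≈⟨ +-congˡ (-‿cong (*-congʳ (fromℕ-+ (toℕ x) S))) ⟩
           rounded x + X - (fromℕ (toℕ x) + fromℕ S) / fromℕ R
             ≈⟨ solve 5 (λ r X t S i → r :+ X :- (t :+ S) :* i := (r :- t :* i) :+ (X :- S :* i)) refl
                  (rounded x) X (fromℕ (toℕ x)) (fromℕ S) (fromℕ R ⁻¹) ⟩
           (rounded x - scaled x) + (X - fromℕ S / fromℕ R) ∎)) ⟩
    2# * ∣ (rounded x - scaled x) + (X - fromℕ S / fromℕ R) ∣
      ≤⟨ *-monoˡ-≤ (proj₁ 0<2) (∣x+y∣≤∣x∣+∣y∣ _ _) ⟩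
    2# * (∣ rounded x - scaled x ∣ + ∣ X - fromℕ S / fromℕ R ∣)
      ≈⟨ solve 2 (λ a b → con (+ 2) :* (a :+ b) := con (+ 2) :* a :+ con (+ 2) :* b) refl _ _ ⟩
    2# * ∣ rounded x - scaled x ∣ + 2# * ∣ X - fromℕ S / fromℕ R ∣
      ≤⟨ +-mono-≤ (round-error υ (0≤scaled x) (scaled≤1 x)) (rounding-error n h) ⟩
    2^ (ℤ.- υ) + fromℕ n * 2^ (ℤ.- υ)
      ≈⟨ solve 2 (λ u n → u :+ n :* u := (con (+ 1) :+ n) :* u) refl (2^ (ℤ.- υ)) (fromℕ n) ⟩
    fromℕ (suc n) * 2^ (ℤ.- υ) ∎
    where
    X : Carrier
    X = sumℝ (take n (List.map rounded h))
    S : ℕ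
    S = sum (take n (List.map toℕ h))

  module _ (0<k : 0# < fromℤ k) where

    0<W/k : 0# < W/k
    0<W/k = *-pos 0<ℝW (⁻¹-pos 0<k)

    0≤remainder : ∀ h → 0# ≤ remainder h
    0≤remainder []      = ≤-refl
    0≤remainder (x ∷ h) = x≤y⇒0≤y-x
      (≤-respʳ-≈ (/-cancelʳ _ 0<W/k) (*-monoʳ-≤ (proj₁ 0<W/k) (⌊⌋-lower _)))

    remainder<W/k : ∀ h → remainder h < W/k
    remainder<W/k []      = 0<W/k
    remainder<W/k (x ∷ h) = ≰⇒> λ q≤r → <⇒≱ (⌊⌋-upper (a / W/k)) (≤-/ 0<W/k
      (≤-by-difference (x≤y⇒0≤y-x q≤r)
        (solve 3 (λ a c q → a :- (c :+ con (+ 1)) :* q := (a :- c :* q) :- q) refl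
          a (fromℤ (cell h x)) W/k)))
      where
      a : Carrier
      a = remainder h + rounded x

    W/k*k : W/k * fromℤ k ≈ fromℕ W
    W/k*k = /-cancelʳ (fromℕ W) 0<k

    -- The answer is off by R times the sum of the rounding errors a and the
    -- distance of the remainder y₀ at the beginning of the window from the
    -- middle q/2 of its range [0, W/k).
    additive-error : ∀ {ε} → 1# ≤ fromℤ k * (2# * ε - 2^ (ℤ.- υ)) →
      IsAdditiveApproximation W R (fromℕ R * fromℕ W * ε) (λ xs → query (run xs))
    additive-error {ε} 1≤kD xs = begin
      ∣ query (run xs) - fromℕ S ∣  ≈⟨ ∣∣-resp-≈ query-error ⟩
      ∣ r * (a + (y₀ - q/2)) ∣      ≤⟨ ∣∣-least
        (≤-respʳ-≈ (sym (*-assoc _ _ _)) (*-monoˡ-≤ (proj₁ 0<ℝR) upper))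
        (≤-respˡ-≈ (solve 2 (λ r e → r :* :- e := :- (r :* e)) refl r _)
          (≤-respʳ-≈ (sym (*-assoc _ _ _)) (*-monoˡ-≤ (proj₁ 0<ℝR) lower))) ⟩
      r * w * ε                     ∎
      where
      h : History
      h = reverse xs
      S : ℕ
      S = windowSum W xs
      r w u X a y₀ q/2 : Carrier
      r = fromℕ R
      w = fromℕ W
      u = 2^ (ℤ.- υ)
      X = sumℝ (take W (List.map rounded h))
      a = X - fromℕ S / r
      y₀ = remainder (drop W h)
      q/2 = w / (2# * fromℤ k)

      double-q/2 : 2# * q/2 ≈ W/k
      double-q/2 = *-cancelʳ-≈ 0<k (begin-equality
        2# * q/2 * fromℤ k
          ≈⟨ solve 2 (λ q k → con (+ 2) :* q :* k := q :* (con (+ 2) :* k)) refl q/2 (fromℤ k) ⟩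
        q/2 * (2# * fromℤ k)    ≈⟨ /-cancelʳ w (*-pos 0<2 0<k) ⟩
        w                       ≈⟨ W/k*k ⟨
        W/k * fromℤ k           ∎)

      query-error : query (run xs) - fromℕ S ≈ r * (a + (y₀ - q/2))
      query-error = begin-equality
        query (run xs) - fromℕ S
          ≡⟨ ≡.cong (λ s → query s - fromℕ S) (run≡after xs) ⟩
        r * (W/k * fromℤ (State.B (after h)) + remainder h - q/2) - fromℕ S
          ≡⟨ ≡.cong (λ B → r * (W/k * fromℤ B + remainder h - q/2) - fromℕ S) (total-written h) ⟩
        r * (W/k * fromℤ (sumℤ (take W (written h))) + remainder h - q/2) - fromℕ S
          ≈⟨ +-cong (*-congˡ (+-congʳ (telescope W h))) (-‿cong (sym (/-cancelʳ (fromℕ S) 0<ℝR))) ⟩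
        r * (X + y₀ - q/2) - fromℕ S / r * r
          ≈⟨ solve 5 (λ r X y q s → r :* (X :+ y :- q) :- s :* r := r :* ((X :- s) :+ (y :- q))) refl
               r X y₀ q/2 (fromℕ S / r) ⟩
        r * (a + (y₀ - q/2)) ∎

      W/k≤ : W/k ≤ w * (2# * ε - u)
      W/k≤ = /-≤ 0<k (≤-by-difference (*-nonneg (proj₁ 0<ℝW) (x≤y⇒0≤y-x 1≤kD))
        (solve 3 (λ w k d → w :* d :* k :- w := w :* (k :* d :- con (+ 1))) refl w (fromℤ k) _))

      double-cancel : ∀ {x y} → 2# * x ≤ 2# * y → x ≤ y
      double-cancel p = *-cancelʳ-≤ 0<2 (≤-respˡ-≈ (*-comm _ _) (≤-respʳ-≈ (*-comm _ _) p))

      total-error : w * u + W/k ≤ 2# * (w * ε)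
      total-error = ≤-by-difference (x≤y⇒0≤y-x W/k≤)
        (solve 4 (λ w u e q → con (+ 2) :* (w :* e) :- (w :* u :+ q) := w :* (con (+ 2) :* e :- u) :- q) refl
          w u ε W/k)

      upper : a + (y₀ - q/2) ≤ w * ε
      upper = double-cancel (begin
        2# * (a + (y₀ - q/2))
          ≈⟨ solve 3 (λ a y q → con (+ 2) :* (a :+ (y :- q))
               := con (+ 2) :* a :+ (con (+ 2) :* y :- con (+ 2) :* q)) refl
               a y₀ q/2 ⟩
        2# * a + (2# * y₀ - 2# * q/2)      ≈⟨ +-congˡ (+-congˡ (-‿cong double-q/2)) ⟩
        2# * a + (2# * y₀ - W/k)           ≤⟨ +-mono-≤
                                                (≤-trans (*-monoˡ-≤ (proj₁ 0<2) (x≤∣x∣ a)) (rounding-error W h))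
                                                (≤-by-difference (+-nonneg y₀≤q y₀≤q)
                                                  (solve 2 (λ y q → q :- (con (+ 2) :* y :- q) := (q :- y) :+ (q :- y)) refl y₀ W/k)) ⟩
        w * u + W/k                        ≤⟨ total-error ⟩
        2# * (w * ε)                       ∎)
        where
        y₀≤q : 0# ≤ W/k - y₀
        y₀≤q = x≤y⇒0≤y-x (proj₁ (remainder<W/k (drop W h)))

      lower : - (a + (y₀ - q/2)) ≤ w * ε
      lower = double-cancel (begin
        2# * - (a + (y₀ - q/2))
          ≈⟨ solve 3 (λ a y q → con (+ 2) :* :- (a :+ (y :- q))
               := con (+ 2) :* :- a :+ (con (+ 2) :* q :- con (+ 2) :* y)) refl
               a y₀ q/2 ⟩
        2# * - a + (2# * q/2 - 2# * y₀)     ≈⟨ +-congˡ (+-congʳ double-q/2) ⟩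
        2# * - a + (W/k - 2# * y₀)          ≤⟨ +-mono-≤
                                                (≤-trans (*-monoˡ-≤ (proj₁ 0<2) (-x≤∣x∣ a)) (rounding-error W h))
                                                (≤-by-difference (+-nonneg 0≤y₀ 0≤y₀)
                                                  (solve 2 (λ y q → q :- (q :- con (+ 2) :* y) := y :+ y) refl y₀ W/k)) ⟩
        w * u + W/k                         ≤⟨ total-error ⟩
        2# * (w * ε)                        ∎)
        where
        0≤y₀ : 0# ≤ y₀
        0≤y₀ = 0≤remainder (drop W h)

    0≤cell : ∀ h x → + 0 ℤ.≤ cell h x
    0≤cell h x = ⌊⌋-greatest (*-nonneg
      (+-nonneg (0≤remainder h) (0≤round υ (0≤scaled x) (scaled≤1 x))) (proj₁ (⁻¹-pos 0<W/k)))

    0≤written : ∀ h → All (+ 0 ℤ.≤_) (written h)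
    0≤written []      = []
    0≤written (x ∷ h) = 0≤cell h x ∷ 0≤written h

    -- A property of 0 and of every value ever written holds of all cells.
    cells : ∀ {p} (P : ℤ → Set p) → P (+ 0) → (∀ h x → P (cell h x)) →
            ∀ h j → P (lookup (State.b (after h)) j)
    cells P P0 Pcell []      j = ≡.subst P (≡.sym (Vec.lookup-replicate j (+ 0))) P0
    cells P P0 Pcell (x ∷ h) j with j Fin.≟ State.i (after h)
    ... | yes ≡.refl = ≡.subst P
      (≡.sym (Vec.lookup∘update j (State.b (after h)) (cell h x))) (Pcell h x)
    ... | no  j≢i    = ≡.subst P
      (≡.sym (Vec.lookup∘update′ j≢i (State.b (after h)) (cell h x))) (cells P P0 Pcell h j)

    module _ (0≤υ : + 0 ℤ.≤ υ) where

      rounded≤1 : ∀ x → rounded x ≤ 1#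
      rounded≤1 x = round≤1 0≤υ (0≤scaled x) (scaled≤1 x)

      cell≤ : ∀ h x → cell h x ℤ.≤ ⌊ 1# + fromℤ k / fromℕ W ⌋
      cell≤ h x = ⌊⌋-greatest (≤-trans (⌊⌋-lower _) (/-≤ 0<W/k (begin
        remainder h + rounded x              ≤⟨ +-mono-≤ (proj₁ (remainder<W/k h)) (rounded≤1 x) ⟩
        W/k + 1#                             ≈⟨ +-congˡ (⁻¹-cancelʳ 0<ℝW) ⟨
        W/k + w * w ⁻¹                       ≈⟨ +-congˡ (*-congʳ W/k*k) ⟨
        W/k + W/k * fromℤ k * w ⁻¹
          ≈⟨ solve 3 (λ q k w⁻¹ → q :+ q :* k :* w⁻¹ := (con (+ 1) :+ k :* w⁻¹) :* q) refl W/k (fromℤ k) (w ⁻¹) ⟩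
        (1# + fromℤ k / w) * W/k             ∎)))
        where
        w : Carrier
        w = fromℕ W

      written≤ : ∀ h → All (ℤ._≤ ⌊ 1# + fromℤ k / fromℕ W ⌋) (written h)
      written≤ []      = []
      written≤ (x ∷ h) = cell≤ h x ∷ written≤ h

      -- Each step adds a multiple of 2^ (- υ) to the remainder and subtracts
      -- a multiple of W / k.
      remainder-integral : ∀ h → ∃ λ a → remainder h * (2^ υ * fromℤ k) ≈ fromℤ a
      remainder-integral []      = + 0 , zeroˡ _
      remainder-integral (x ∷ h) =
        (a ℤ.+ m ℤ.* k) ℤ.- b ℤ.* (+ W ℤ.* p) , (begin-equality
          (y + r - β * W/k) * (2^ υ * κ)
            ≈⟨ solve 5 (λ y r c q s → (y :+ r :- c :* q) :* s := y :* s :+ r :* s :- c :* (q :* s)) refl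
                 y r β W/k (2^ υ * κ) ⟩
          y * (2^ υ * κ) + r * (2^ υ * κ) - β * (W/k * (2^ υ * κ))
            ≈⟨ +-cong
                 (+-congˡ (solve 3 (λ r p k → r :* (p :* k) := p :* r :* k) refl r (2^ υ) κ))
                 (-‿cong (*-congˡ (solve 3 (λ q p k → q :* (p :* k) := q :* k :* p) refl W/k (2^ υ) κ))) ⟩
          y * (2^ υ * κ) + 2^ υ * r * κ - β * (W/k * κ * 2^ υ)
            ≈⟨ +-cong (+-cong (proj₂ (remainder-integral h)) (*-congʳ (proj₂ grid)))
                 (-‿cong (*-congˡ (*-cong W/k*k (proj₂ power)))) ⟩
          fromℤ a + fromℤ m * κ - β * (fromℕ W * fromℤ p)
            ≈⟨ +-cong (trans (fromℤ-+ a (m ℤ.* k)) (+-congˡ (fromℤ-* m k)))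
                 (-‿cong (trans (fromℤ-* b (+ W ℤ.* p)) (*-congˡ (fromℤ-* (+ W) p)))) ⟨
          fromℤ (a ℤ.+ m ℤ.* k) - fromℤ (b ℤ.* (+ W ℤ.* p))
            ≈⟨ fromℤ-- (a ℤ.+ m ℤ.* k) (b ℤ.* (+ W ℤ.* p)) ⟨
          fromℤ ((a ℤ.+ m ℤ.* k) ℤ.- b ℤ.* (+ W ℤ.* p)) ∎)
        where
        grid : ∃ λ m → 2^ υ * rounded x ≈ fromℤ m
        grid = onGrid υ (scaled x) (0≤scaled x) (scaled≤1 x)
        power : ∃ λ p → 2^ υ ≈ fromℤ p
        power = 2^-integral 0≤υ
        a m p b : ℤ
        a = proj₁ (remainder-integral h)
        m = proj₁ grid
        p = proj₁ power
        b = cell h x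
        y r β κ : Carrier
        y = remainder h
        r = rounded x
        β = fromℤ b
        κ = fromℤ k

      remainder-exact : ∀ h → ∃ λ n → (remainder h * (2^ υ * fromℤ k) ≈ fromℕ n)
                                    × (fromℕ n < fromℕ W * 2^ υ)
      remainder-exact h = ℤ.∣ a ∣ , exact , ≤-<-trans (≤-reflexive (sym exact)) (begin-strict
        remainder h * s         <⟨ *-monoʳ-< 0<s (remainder<W/k h) ⟩
        W/k * (2^ υ * fromℤ k)  ≈⟨ solve 3 (λ q p k → q :* (p :* k) := q :* k :* p) refl W/k (2^ υ) (fromℤ k) ⟩
        W/k * fromℤ k * 2^ υ    ≈⟨ *-congʳ W/k*k ⟩
        fromℕ W * 2^ υ          ∎)
        where
        a : ℤ
        a = proj₁ (remainder-integral h)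
        s : Carrier
        s = 2^ υ * fromℤ k
        0<s : 0# < s
        0<s = *-pos (2^-pos υ) 0<k
        0≤a : + 0 ℤ.≤ a
        0≤a = fromℤ-cancel-≤ (≤-respʳ-≈ (proj₂ (remainder-integral h))
          (*-nonneg (0≤remainder h) (proj₁ 0<s)))
        exact : remainder h * s ≈ fromℕ ℤ.∣ a ∣
        exact = trans (proj₂ (remainder-integral h))
          (reflexive (≡.cong fromℤ (≡.sym (ℤ.0≤i⇒+∣i∣≡i 0≤a))))

-- The parameters and the memory for a fixed window size

module Width {c ℓ₁ ℓ₂} (ℝ : RealField c ℓ₁ ℓ₂) (ε : ℕ → RealField.Carrier ℝ)
  (W : ℕ) .{{W≢0 : NonZero W}}
  (0<ε : RealField._<_ ℝ (RealField.0# ℝ) (ε W)) where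

  open RealField ℝ
  open Summing ℝ
  open OrderedField ℝ
  open Parameters ε
  open PosetReasoning poset

  -- The grid step u, the number D whose inverse is rounded up to k, and W and
  -- k as field elements.
  w u D κ : Carrier
  w = fromℕ W
  u = 2^ (ℤ.- υ W)
  D = 2# * ε W - u
  κ = fromℤ (k W)

  0<w : 0# < w
  0<w = fromℕ-pos W

  1≤w : 1# ≤ w
  1≤w = ≤-respˡ-≈ fromℕ-1 (fromℕ-mono-≤ {1} {W} (ℕ.>-nonZero⁻¹ W))

  0<W/ε : 0# < ε W ⁻¹ * w
  0<W/ε = *-pos (⁻¹-pos 0<ε) 0<w

  -- 2^ υ is at least W / ε, as υ rounds the logarithm of W / ε up.
  W/ε≤2^υ : ε W ⁻¹ * w ≤ 2^ (υ W)
  W/ε≤2^υ = log₂-cancel-≤ (2^-pos (υ W))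
    (≤-respʳ-≈ (sym (log₂-2^ (υ W))) (⌈⌉-upper _))

  u≤ε : u ≤ ε W
  u≤ε = begin
    u                              ≈⟨ *-identityʳ u ⟨
    u * 1#                         ≤⟨ *-monoˡ-≤ 0≤u 1≤w ⟩
    u * w                          ≈⟨ *-identityʳ _ ⟨
    u * w * 1#                     ≈⟨ *-congˡ (⁻¹-cancelʳ 0<ε) ⟨
    u * w * (ε W * ε W ⁻¹)
      ≈⟨ solve 4 (λ u w e e⁻¹ → u :* w :* (e :* e⁻¹) := u :* e :* (e⁻¹ :* w)) refl u w (ε W) (ε W ⁻¹) ⟩
    u * ε W * (ε W ⁻¹ * w)         ≤⟨ *-monoˡ-≤ (*-nonneg 0≤u (proj₁ 0<ε)) W/ε≤2^υ ⟩
    u * ε W * 2^ (υ W)             ≈⟨ solve 3 (λ u e p → u :* e :* p := e :* (u :* p)) refl u (ε W) (2^ (υ W)) ⟩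
    ε W * (u * 2^ (υ W))           ≈⟨ *-congˡ (2^-inverse (υ W)) ⟩
    ε W * 1#                       ≈⟨ *-identityʳ _ ⟩
    ε W                            ∎
    where
    0≤u : 0# ≤ u
    0≤u = proj₁ (2^-pos (ℤ.- υ W))

  ε≤D : ε W ≤ D
  ε≤D = ≤-by-difference (x≤y⇒0≤y-x u≤ε)
    (solve 2 (λ e u → con (+ 2) :* e :- u :- e := e :- u) refl (ε W) u)

  0<D : 0# < D
  0<D = <-≤-trans 0<ε ε≤D

  0<κ : 0# < κ
  0<κ = <-≤-trans (*-pos 0<1 (⁻¹-pos 0<D)) (⌈⌉-upper _)

  1≤κD : 1# ≤ κ * D
  1≤κD = ≤-respˡ-≈ (/-cancelʳ 1# 0<D) (*-monoʳ-≤ (proj₁ 0<D) (⌈⌉-upper _))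

  1≤2κε : 1# ≤ 2# * (κ * ε W)
  1≤2κε = ≤-trans 1≤κD (≤-by-difference (*-nonneg (proj₁ 0<κ) (proj₁ (2^-pos (ℤ.- υ W))))
    (solve 3 (λ k e u → con (+ 2) :* (k :* e) :- k :* (con (+ 2) :* e :- u) := k :* u) refl κ (ε W) u))

  κ≤ : κ ≤ ε W ⁻¹ + 1#
  κ≤ = ≤-trans (⌈⌉-lower _) (+-monoˡ-≤ 1# (/-≤ 0<D (≤-trans
    (≤-reflexive (trans (sym (⁻¹-cancelʳ 0<ε)) (*-comm _ _)))
    (*-monoˡ-≤ (proj₁ (⁻¹-pos 0<ε)) ε≤D))))

  -- Consequences of a small error

  module _ (2Wε≤1 : 2# * (w * ε W) ≤ 1#) where

    1≤W/ε : 1# ≤ ε W ⁻¹ * w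
    1≤W/ε = begin
      1#               ≈⟨ trans (sym (⁻¹-cancelʳ 0<ε)) (*-comm _ _) ⟩
      ε W ⁻¹ * ε W     ≤⟨ *-monoˡ-≤ (proj₁ (⁻¹-pos 0<ε)) ε≤w ⟩
      ε W ⁻¹ * w       ∎
      where
      ε≤w : ε W ≤ w
      ε≤w = ≤-by-difference
        (+-nonneg (+-nonneg (x≤y⇒0≤y-x 2Wε≤1) (x≤y⇒0≤y-x 1≤w))
          (*-nonneg (+-nonneg (+-nonneg (x≤y⇒0≤y-x 1≤w) (x≤y⇒0≤y-x 1≤w)) 0≤1) (proj₁ 0<ε)))
        (solve 2 (λ w e → w :- e := (con (+ 1) :- con (+ 2) :* (w :* e)) :+ (w :- con (+ 1))
                                    :+ ((w :- con (+ 1)) :+ (w :- con (+ 1)) :+ con (+ 1)) :* e)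
           refl w (ε W))

    0≤υ : + 0 ℤ.≤ υ W
    0≤υ = 0≤⌈⌉ (0≤log₂ 1≤W/ε)

    w≤κ : w ≤ κ
    w≤κ = begin
      w                        ≈⟨ *-identityʳ w ⟨
      w * 1#                   ≤⟨ *-monoˡ-≤ (proj₁ 0<w) 1≤2κε ⟩
      w * (2# * (κ * ε W))
        ≈⟨ solve 3 (λ w k e → w :* (con (+ 2) :* (k :* e)) := k :* (con (+ 2) :* (w :* e))) refl w κ (ε W) ⟩
      κ * (2# * (w * ε W))     ≤⟨ *-monoˡ-≤ (proj₁ 0<κ) 2Wε≤1 ⟩
      κ * 1#                   ≈⟨ *-identityʳ κ ⟩
      κ                        ∎

    fits : ∀ round → IsRounding round → ∀ R → .{{_ : NonZero R}} →
           let open Algorithm round W R (υ W) (k W) in ∀ xs → Fits W (run xs)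
    fits round isRounding R xs = ≡.subst (Fits W) (≡.sym (run≡after xs)) (record
      { cell-lower = λ j → cells 0<κ (+ 0 ℤ.≤_) ℤ.≤-refl (0≤cell 0<κ) h j
      ; cell-upper = λ j → cells 0<κ (ℤ._≤ maxCell W) 0≤maxCell (cell≤ 0<κ 0≤υ) h j
      ; B-lower    = ≡.subst (+ 0 ℤ.≤_) (≡.sym (total-written h))
                       (sumℤ-take-nonneg W (0≤written 0<κ h))
      ; B-upper    = ≡.subst (ℤ._≤ + W ℤ.* maxCell W) (≡.sym (total-written h))
                       (sumℤ-take-≤ 0≤maxCell W (written≤ 0<κ 0≤υ h))
      ; y-lower    = 0≤remainder 0<κ h
      ; y-upper    = <-≤-trans (remainder<W/k 0<κ h) (/-≤ 0<κ (≤-respʳ-≈ (sym (*-identityˡ κ)) w≤κ))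
      ; y-exact    = remainder-exact 0<κ 0≤υ h
      })
      where
      open Trace ℝ round isRounding W R (υ W) (k W)
      h : History
      h = reverse xs
      0≤maxCell : + 0 ℤ.≤ maxCell W
      0≤maxCell = ⌊⌋-greatest (+-nonneg 0≤1 (*-nonneg (proj₁ 0<κ) (proj₁ (⁻¹-pos 0<w))))

  -- Size of the variables

  -- T is the number inside the logarithm of ℬ, so ℬ W is w * L by definition.
  t T L : Carrier
  t = 1# / (fromℕ 4 * w * ε W)
  T = fromℤ ⌊ t + 1# ⌋
  L = log₂ T

  0<4Wε : 0# < fromℕ 4 * w * ε W
  0<4Wε = *-pos (*-pos (fromℕ-pos 4) 0<w) 0<ε

  t≤T : t ≤ T
  t≤T = ≤-by-difference (x≤y⇒0≤y-x (proj₁ (⌊⌋-upper (t + 1#))))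
    (solve 2 (λ t T → T :- t := T :+ con (+ 1) :- (t :+ con (+ 1))) refl t T)

  1≤T : 1# ≤ T
  1≤T = ≤-respˡ-≈ fromℕ-1 (fromℤ-mono-≤ (⌊⌋-greatest {+ 1} (≤-respˡ-≈ (sym fromℕ-1)
    (≤-respˡ-≈ (+-identityˡ 1#) (+-monoˡ-≤ 1# (*-nonneg 0≤1 (proj₁ (⁻¹-pos 0<4Wε))))))))

  0<T : 0# < T
  0<T = <-≤-trans 0<1 1≤T

  4tw≈ε⁻¹ : 2# * (2# * (t * w)) ≈ ε W ⁻¹
  4tw≈ε⁻¹ = *-cancelʳ-≈ 0<ε (begin-equality
    2# * (2# * (t * w)) * ε W
      ≈⟨ solve 3 (λ t w e → con (+ 2) :* (con (+ 2) :* (t :* w)) :* e := t :* (con (+ 4) :* w :* e)) refl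
           t w (ε W) ⟩
    t * (⟦ + 4 ⟧ * w * ε W)             ≈⟨ *-congˡ (*-congʳ (*-congʳ (fromℤ≈⟦⟧ (+ 4)))) ⟨
    t * (fromℕ 4 * w * ε W)             ≈⟨ /-cancelʳ 1# 0<4Wε ⟩
    1#                                  ≈⟨ trans (sym (⁻¹-cancelʳ 0<ε)) (*-comm _ _) ⟩
    ε W ⁻¹ * ε W                        ∎)

  -- The largest cell value, 8 T, and the logarithm of W.
  M 8T λw : Carrier
  M = fromℤ (maxCell W)
  8T = 2# * (2# * (2# * T))
  λw = log₂ w

  -- As 1 ≤ 2 k ε and 4 t W = 1 / ε, even 2 t W ≤ k holds.
  T≤M : T ≤ M
  T≤M = fromℤ-mono-≤ (⌊⌋-greatest {⌊ t + 1# ⌋} (≤-trans (⌊⌋-lower (t + 1#)) (begin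
    t + 1#      ≤⟨ +-monoˡ-≤ 1# (≤-/ 0<w tw≤κ) ⟩
    κ / w + 1#  ≈⟨ solve 1 (λ x → x :+ con (+ 1) := con (+ 1) :+ x) refl (κ / w) ⟩
    1# + κ / w  ∎)))
    where
    2tw≤κ : 2# * (t * w) ≤ κ
    2tw≤κ = *-cancelʳ-≤ 0<2 (begin
      2# * (t * w) * 2#            ≈⟨ *-comm _ _ ⟩
      2# * (2# * (t * w))          ≈⟨ 4tw≈ε⁻¹ ⟩
      ε W ⁻¹                       ≈⟨ *-identityʳ _ ⟨
      ε W ⁻¹ * 1#                  ≤⟨ *-monoˡ-≤ (proj₁ (⁻¹-pos 0<ε)) 1≤2κε ⟩
      ε W ⁻¹ * (2# * (κ * ε W))
        ≈⟨ solve 3 (λ k e e⁻¹ → e⁻¹ :* (con (+ 2) :* (k :* e)) := k :* con (+ 2) :* (e :* e⁻¹)) refl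
             κ (ε W) (ε W ⁻¹) ⟩
      κ * 2# * (ε W * ε W ⁻¹)      ≈⟨ *-congˡ (⁻¹-cancelʳ 0<ε) ⟩
      κ * 2# * 1#                  ≈⟨ *-identityʳ _ ⟩
      κ * 2#                       ∎)
    tw≤κ : t * w ≤ κ
    tw≤κ = ≤-trans (≤-by-difference (*-nonneg (*-nonneg 0≤1 (proj₁ (⁻¹-pos 0<4Wε))) (proj₁ 0<w))
      (solve 1 (λ x → con (+ 2) :* x :- x := x) refl (t * w))) 2tw≤κ

  0<M : 0# < M
  0<M = <-≤-trans 0<T T≤M

  -- M ≤ 1 + k / W ≤ 4 t + 2, hence M + 1 ≤ 4 T + 3 ≤ 8 T.
  M+1≤8T : M + 1# ≤ 8T
  M+1≤8T = begin
    M + 1#                       ≤⟨ +-monoˡ-≤ 1# (⌊⌋-lower _) ⟩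
    1# + κ / w + 1#              ≤⟨ +-monoˡ-≤ 1# (+-monoʳ-≤ 1# (/-≤ 0<w κ≤′)) ⟩
    1# + (4t + 1#) + 1#          ≤⟨ ≤-by-difference
      (+-nonneg (+-nonneg (quadruple (x≤y⇒0≤y-x t≤T)) (quadruple (x≤y⇒0≤y-x 1≤T))) 0≤1)
      (solve 2 (λ t T → con (+ 2) :* (con (+ 2) :* (con (+ 2) :* T))
                          :- (con (+ 1) :+ (con (+ 2) :* (con (+ 2) :* t) :+ con (+ 1)) :+ con (+ 1))
                        := con (+ 2) :* (con (+ 2) :* (T :- t))
                           :+ con (+ 2) :* (con (+ 2) :* (T :- con (+ 1))) :+ con (+ 1))
        refl t T) ⟩
    8T                           ∎
    where
    4t : Carrier
    4t = 2# * (2# * t)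
    quadruple : ∀ {x} → 0# ≤ x → 0# ≤ 2# * (2# * x)
    quadruple 0≤x = *-nonneg (proj₁ 0<2) (*-nonneg (proj₁ 0<2) 0≤x)
    κ≤′ : κ ≤ (4t + 1#) * w
    κ≤′ = begin
      κ                          ≤⟨ κ≤ ⟩
      ε W ⁻¹ + 1#                ≤⟨ +-mono-≤ (≤-reflexive (sym 4tw≈ε⁻¹)) 1≤w ⟩
      2# * (2# * (t * w)) + w
        ≈⟨ solve 2 (λ t w → con (+ 2) :* (con (+ 2) :* (t :* w)) :+ w
             := (con (+ 2) :* (con (+ 2) :* t) :+ con (+ 1)) :* w) refl
             t w ⟩
      (4t + 1#) * w              ∎

  log₂-double : ∀ {x} → 0# < x → log₂ (2# * x) ≈ 1# + log₂ x
  log₂-double 0<x = trans (log₂-* 0<2 0<x) (+-congʳ log₂-2)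

  double-pos : ∀ {x} → 0# < x → 0# < 2# * x
  double-pos = *-pos 0<2

  0<8T : 0# < 8T
  0<8T = double-pos (double-pos (double-pos 0<T))

  log₂-8T : log₂ 8T ≈ 1# + (1# + (1# + L))
  log₂-8T = trans (log₂-double (double-pos (double-pos 0<T)))
    (+-congˡ (trans (log₂-double (double-pos 0<T)) (+-congˡ (log₂-double 0<T))))

  -- The summands of memory as field elements.
  υ′ cellBits indexBits totalBits : Carrier
  υ′ = fromℤ (υ W)
  cellBits  = fromℤ (bits (maxCell W ℤ.+ + 1))
  indexBits = fromℤ (bits (+ W))
  totalBits = fromℤ (bits (+ W ℤ.* maxCell W ℤ.+ + 1))

  bits≤ : ∀ n {x} → 0# < fromℤ n → fromℤ n ≤ x → fromℤ (bits n) ≤ log₂ x + 1#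
  bits≤ n 0<n n≤x = ≤-trans (⌈⌉-lower _) (+-monoˡ-≤ 1# (log₂-mono-≤ 0<n n≤x))

  0≤bits : ∀ n → 1# ≤ fromℤ n → 0# ≤ fromℤ (bits n)
  0≤bits n 1≤n = ≤-trans (0≤log₂ 1≤n) (⌈⌉-upper _)

  M+1 : fromℤ (maxCell W ℤ.+ + 1) ≈ M + 1#
  M+1 = fromℤ-suc (maxCell W)

  0<M+1 : 0# < fromℤ (maxCell W ℤ.+ + 1)
  0<M+1 = <-≤-trans 0<M (≤-respʳ-≈ (sym M+1) (proj₁ (x<x+1 M)))

  WM+1 : fromℤ (+ W ℤ.* maxCell W ℤ.+ + 1) ≈ w * M + 1#
  WM+1 = trans (fromℤ-suc (+ W ℤ.* maxCell W)) (+-congʳ (fromℤ-* (+ W) (maxCell W)))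

  1≤WM+1 : 1# ≤ fromℤ (+ W ℤ.* maxCell W ℤ.+ + 1)
  1≤WM+1 = ≤-respʳ-≈ (sym WM+1)
    (≤-respˡ-≈ (+-identityˡ 1#) (+-monoˡ-≤ 1# (*-nonneg (proj₁ 0<w) (proj₁ 0<M))))

  -- W / ε = 4 t W² ≤ 4 T W².
  υ≤ : υ′ ≤ 1# + (1# + (λw + (λw + L))) + 1#
  υ≤ = ≤-trans (⌈⌉-lower _) (+-monoˡ-≤ 1# (begin
    log₂ (ε W ⁻¹ * w)                     ≤⟨ log₂-mono-≤ 0<W/ε bound ⟩
    log₂ (2# * (2# * (w * (w * T))))      ≈⟨ log₂-double (double-pos 0<wwT) ⟩
    1# + log₂ (2# * (w * (w * T)))        ≈⟨ +-congˡ (log₂-double 0<wwT) ⟩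
    1# + (1# + log₂ (w * (w * T)))        ≈⟨ +-congˡ (+-congˡ (trans (log₂-* 0<w 0<wT) (+-congˡ (log₂-* 0<w 0<T)))) ⟩
    1# + (1# + (λw + (λw + L)))           ∎))
    where
    0<wT : 0# < w * T
    0<wT = *-pos 0<w 0<T
    0<wwT : 0# < w * (w * T)
    0<wwT = *-pos 0<w 0<wT
    bound : ε W ⁻¹ * w ≤ 2# * (2# * (w * (w * T)))
    bound = begin
      ε W ⁻¹ * w                    ≈⟨ *-congʳ 4tw≈ε⁻¹ ⟨
      2# * (2# * (t * w)) * w
        ≈⟨ solve 2 (λ t w → con (+ 2) :* (con (+ 2) :* (t :* w)) :* w
             := con (+ 2) :* (con (+ 2) :* (w :* (w :* t)))) refl
             t w ⟩
      2# * (2# * (w * (w * t)))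
        ≤⟨ *-monoˡ-≤ (proj₁ 0<2) (*-monoˡ-≤ (proj₁ 0<2)
             (*-monoˡ-≤ (proj₁ 0<w) (*-monoˡ-≤ (proj₁ 0<w) t≤T))) ⟩
      2# * (2# * (w * (w * T)))     ∎

  cellBits≤ : cellBits ≤ 1# + (1# + (1# + L)) + 1#
  cellBits≤ = ≤-respʳ-≈ (+-congʳ log₂-8T)
    (bits≤ (maxCell W ℤ.+ + 1) 0<M+1 (≤-respˡ-≈ (sym M+1) M+1≤8T))

  L≤cellBits : L ≤ cellBits
  L≤cellBits = ≤-trans (log₂-mono-≤ 0<T (≤-trans T≤M (≤-respʳ-≈ (sym M+1) (proj₁ (x<x+1 M)))))
                       (⌈⌉-upper _)

  indexBits≤ : indexBits ≤ λw + 1#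
  indexBits≤ = bits≤ (+ W) 0<w ≤-refl

  totalBits≤ : totalBits ≤ λw + (1# + (1# + (1# + L))) + 1#
  totalBits≤ = ≤-respʳ-≈ (+-congʳ (trans (log₂-* 0<w 0<8T) (+-congˡ log₂-8T)))
    (bits≤ (+ W ℤ.* maxCell W ℤ.+ + 1) (<-≤-trans 0<1 1≤WM+1) (begin
      fromℤ (+ W ℤ.* maxCell W ℤ.+ + 1)  ≈⟨ WM+1 ⟩
      w * M + 1#                         ≤⟨ +-monoʳ-≤ (w * M) 1≤w ⟩
      w * M + w                          ≈⟨ solve 2 (λ w m → w :* m :+ w := w :* (m :+ con (+ 1))) refl w M ⟩
      w * (M + 1#)                       ≤⟨ *-monoˡ-≤ (proj₁ 0<w) M+1≤8T ⟩
      w * 8T                             ∎))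

  memory≈ : fromℤ (memory W) ≈ υ′ + w * cellBits + indexBits + totalBits
  memory≈ = begin-equality
    fromℤ (υ W ℤ.+ + W ℤ.* m ℤ.+ i ℤ.+ b)      ≈⟨ fromℤ-+ (υ W ℤ.+ + W ℤ.* m ℤ.+ i) b ⟩
    fromℤ (υ W ℤ.+ + W ℤ.* m ℤ.+ i) + totalBits  ≈⟨ +-congʳ (fromℤ-+ (υ W ℤ.+ + W ℤ.* m) i) ⟩
    fromℤ (υ W ℤ.+ + W ℤ.* m) + indexBits + totalBits
      ≈⟨ +-congʳ (+-congʳ (trans (fromℤ-+ (υ W) (+ W ℤ.* m)) (+-congˡ (fromℤ-* (+ W) m)))) ⟩
    υ′ + w * cellBits + indexBits + totalBits  ∎
    where
    m i b : ℤ
    m = bits (maxCell W ℤ.+ + 1)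
    i = bits (+ W)
    b = bits (+ W ℤ.* maxCell W ℤ.+ + 1)

  losslessMemory≈ : fromℤ (losslessMemory W) ≈ fromℤ (memory W) + indexBits
  losslessMemory≈ = fromℤ-+ (memory W) (bits (+ W))

  memory≤losslessMemory : fromℤ (memory W) ≤ fromℤ (losslessMemory W)
  memory≤losslessMemory = ≤-respʳ-≈ (sym losslessMemory≈)
    (≤-respˡ-≈ (+-identityʳ _) (+-monoʳ-≤ (fromℤ (memory W)) (0≤bits (+ W) 1≤w)))

  ℬ≤memory : + 0 ℤ.≤ υ W → ℬ W ≤ fromℤ (memory W)
  ℬ≤memory 0≤υ = ≤-respʳ-≈ (sym memory≈) (≤-by-difference
    (+-nonneg (+-nonneg (+-nonneg (fromℤ-mono-≤ 0≤υ) (*-nonneg (proj₁ 0<w) (x≤y⇒0≤y-x L≤cellBits)))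
      (0≤bits (+ W) 1≤w)) (0≤bits (+ W ℤ.* maxCell W ℤ.+ + 1) 1≤WM+1))
    (solve 6 (λ u w c i t l → u :+ w :* c :+ i :+ t :- w :* l := u :+ w :* (c :- l) :+ i :+ t) refl
      υ′ w cellBits indexBits totalBits L))

  -- The bounds on the summands add up to W L + 4 W + 5 log W + 2 L + 9; moreover
  -- log W ≤ W and 1 ≤ W.
  losslessMemory≤ : fromℤ (losslessMemory W) ≤ ℬ W + (⟦ + 18 ⟧ * w + 2# * L)
  losslessMemory≤ = begin
    fromℤ (losslessMemory W)
      ≈⟨ trans losslessMemory≈ (+-congʳ memory≈) ⟩
    υ′ + w * cellBits + indexBits + totalBits + indexBits
      ≤⟨ +-mono-≤ (+-mono-≤ (+-mono-≤ (+-mono-≤ υ≤ (*-monoˡ-≤ (proj₁ 0<w) cellBits≤)) indexBits≤) totalBits≤) indexBits≤ ⟩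
    1# + (1# + (λw + (λw + L))) + 1# + w * (1# + (1# + (1# + L)) + 1#) + (λw + 1#)
      + (λw + (1# + (1# + (1# + L))) + 1#) + (λw + 1#)
      ≤⟨ ≤-by-difference (+-nonneg (*-nonneg (nonneg 5) (x≤y⇒0≤y-x (log₂-fromℕ≤ W)))
                                   (*-nonneg (nonneg 9) (x≤y⇒0≤y-x 1≤w)))
         (solve 3 (λ w n l → let one = con (+ 1) in
             (w :* l :+ (con (+ 18) :* w :+ con (+ 2) :* l))
               :- (one :+ (one :+ (n :+ (n :+ l))) :+ one :+ w :* (one :+ (one :+ (one :+ l)) :+ one)
                   :+ (n :+ one) :+ (n :+ (one :+ (one :+ (one :+ l))) :+ one) :+ (n :+ one))
             := con (+ 5) :* (w :- n) :+ con (+ 9) :* (w :- one)) refl w λw L) ⟩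
    ℬ W + (⟦ + 18 ⟧ * w + 2# * L) ∎
    where
    nonneg : ∀ n → 0# ≤ ⟦ + n ⟧
    nonneg n = ≤-respʳ-≈ (fromℤ≈⟦⟧ (+ n)) (0≤fromℕ n)

-- Asymptotics for growing window size

module Asymptotics {c ℓ₁ ℓ₂} (ℝ : RealField c ℓ₁ ℓ₂) where
  open RealField ℝ
  open Summing ℝ
  open OrderedField ℝ
  open PosetReasoning poset

  eventually-∧ : ∀ {p q} {P : ℕ → Set p} {Q : ℕ → Set q} →
                 Eventually P → Eventually Q → Eventually (λ W → P W × Q W)
  eventually-∧ (M , p) (N , q) = M ℕ.⊔ N , λ W M⊔N≤W →
    p W (ℕ.≤-trans (ℕ.m≤m⊔n M N) M⊔N≤W) , q W (ℕ.≤-trans (ℕ.m≤n⊔m M N) M⊔N≤W)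

  eventually-map : ∀ {p q} {P : ℕ → Set p} {Q : ℕ → Set q} →
                   (∀ W → P W → Q W) → Eventually P → Eventually Q
  eventually-map f (N , p) = N , λ W N≤W → f W (p W N≤W)

  eventually-nonZero : Eventually (λ W → NonZero W)
  eventually-nonZero = 1 , λ W → ℕ.>-nonZero

  eventually-large : ∀ x → Eventually (λ W → x ≤ fromℕ W)
  eventually-large x = ℤ.∣ ⌈ x ⌉ ∣ , λ W N≤W → ≤-trans (archimedean x) (fromℕ-mono-≤ N≤W)

  -- If g ≤ f ≤ (1 + η) g eventually for every η > 0, then (f - g) / g is the
  -- required δ.
  ∼-squeeze : ∀ {f g} → Eventually (λ W → 0# < g W × g W ≤ f W) →
              (∀ η → 0# < η → Eventually (λ W → f W ≤ g W + η * g W)) →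
              f ∼ g ·[1+o1]
  ∼-squeeze {f} {g} lower upper = δ , δ=o1 , eventually-map expand lower
    where
    δ : ℕ → Carrier
    δ W = (f W - g W) / g W
    δ=o1 : δ =o (λ _ → 1#)
    δ=o1 η 0<η = eventually-map bound (eventually-∧ lower (upper η 0<η))
      where
      bound : ∀ W → (0# < g W × g W ≤ f W) × f W ≤ g W + η * g W → ∣ δ W ∣ ≤ η * ∣ 1# ∣
      bound W ((0<g , g≤f) , f≤) = begin
        ∣ δ W ∣    ≈⟨ nonneg⇒∣∣≈ (*-nonneg (x≤y⇒0≤y-x g≤f) (proj₁ (⁻¹-pos 0<g))) ⟩
        δ W        ≤⟨ /-≤ 0<g (≤-by-difference (x≤y⇒0≤y-x f≤)
                       (solve 3 (λ f g η → η :* g :- (f :- g) := g :+ η :* g :- f) refl (f W) (g W) η)) ⟩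
        η          ≈⟨ *-identityʳ η ⟨
        η * 1#     ≈⟨ *-congˡ (nonneg⇒∣∣≈ 0≤1) ⟨
        η * ∣ 1# ∣ ∎
    expand : ∀ W → 0# < g W × g W ≤ f W → f W ≈ g W * (1# + δ W)
    expand W (0<g , _) = begin-equality
      f W                        ≈⟨ solve 2 (λ f g → f := g :+ (f :- g)) refl (f W) (g W) ⟩
      g W + (f W - g W)          ≈⟨ +-congˡ (/-cancelʳ _ 0<g) ⟨
      g W + δ W * g W            ≈⟨ solve 2 (λ g d → g :+ d :* g := g :* (con (+ 1) :+ d)) refl (g W) (δ W) ⟩
      g W * (1# + δ W)           ∎

  module _ (ε : ℕ → Carrier) (0<ε : ∀ W → .{{_ : NonZero W}} → 0# < ε W)
           (ε=o : ε =o (λ W → fromℕ W ⁻¹)) where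

    open Parameters ε

    Wε-small : ∀ {a} → 0# < a → Eventually (λ W → a * (fromℕ W * ε W) ≤ 1#)
    Wε-small {a} 0<a =
      eventually-map bound (eventually-∧ eventually-nonZero (ε=o (a ⁻¹) (⁻¹-pos 0<a)))
      where
      bound : ∀ W → NonZero W × ∣ ε W ∣ ≤ a ⁻¹ * ∣ fromℕ W ⁻¹ ∣ → a * (fromℕ W * ε W) ≤ 1#
      bound W (W≢0 , ∣ε∣≤) = begin
        a * (w * ε W)                  ≤⟨ *-monoˡ-≤ (proj₁ 0<a) (*-monoˡ-≤ (proj₁ 0<w)
                                           (≤-trans (x≤∣x∣ (ε W)) ∣ε∣≤)) ⟩
        a * (w * (a ⁻¹ * ∣ w ⁻¹ ∣))    ≈⟨ *-congˡ (*-congˡ (*-congˡ (nonneg⇒∣∣≈ (proj₁ (⁻¹-pos 0<w))))) ⟩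
        a * (w * (a ⁻¹ * w ⁻¹))
          ≈⟨ solve 4 (λ a w a⁻¹ w⁻¹ → a :* (w :* (a⁻¹ :* w⁻¹)) := a :* a⁻¹ :* (w :* w⁻¹)) refl a w (a ⁻¹) (w ⁻¹) ⟩
        a * a ⁻¹ * (w * w ⁻¹)          ≈⟨ *-cong (⁻¹-cancelʳ 0<a) (⁻¹-cancelʳ 0<w) ⟩
        1# * 1#                        ≈⟨ *-identityʳ 1# ⟩
        1#                             ∎
        where
        w : Carrier
        w = fromℕ W
        0<w : 0# < w
        0<w = fromℕ-pos W {{W≢0}}

    -- The logarithmic factor of ℬ.
    logCells : ℕ → Carrier
    logCells W = log₂ (fromℤ ⌊ 1# / (fromℕ 4 * fromℕ W * ε W) + 1# ⌋)

    -- With a natural number n ≥ x, the bound 2^ n * 4 * W * ε ≤ 1 gives 2^ n ≤ 1 / (4 * W * ε).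
    logCells-large : ∀ x → Eventually (λ W → x ≤ logCells W)
    logCells-large x = eventually-map bound
      (eventually-∧ eventually-nonZero (Wε-small (*-pos (2^ⁿ-pos n) (fromℕ-pos 4))))
      where
      n : ℕ
      n = ℤ.∣ ⌈ x ⌉ ∣
      bound : ∀ W → NonZero W × 2# ^ n * fromℕ 4 * (fromℕ W * ε W) ≤ 1# → x ≤ logCells W
      bound W (W≢0 , small) = begin
        x              ≤⟨ archimedean x ⟩
        fromℕ n        ≈⟨ log₂-2^ⁿ n ⟨
        log₂ (2# ^ n)  ≤⟨ log₂-mono-≤ (2^ⁿ-pos n) (≤-trans (≤-/ 0<4Wε
                           (≤-respˡ-≈ (solve 4 (λ p f w e → p :* f :* (w :* e) := p :* (f :* w :* e)) refl
                             (2# ^ n) (fromℕ 4) (fromℕ W) (ε W)) small)) t≤T) ⟩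
        logCells W     ∎
        where
        instance
          _ : NonZero W
          _ = W≢0
        open Width ℝ ε W (0<ε W)

    -- This condition makes υ nonnegative and k at least W.
    Small : ℕ → Set ℓ₂
    Small W = 2# * (fromℕ W * ε W) ≤ 1#

    ℬ-lower : Eventually (λ W → 0# < ℬ W × ℬ W ≤ fromℤ (memory W))
    ℬ-lower = eventually-map bound
      (eventually-∧ eventually-nonZero (eventually-∧ (Wε-small 0<2) (logCells-large 1#)))
      where
      bound : ∀ W → NonZero W × Small W × 1# ≤ logCells W → 0# < ℬ W × ℬ W ≤ fromℤ (memory W)
      bound W (W≢0 , small , 1≤L) = *-pos 0<w (<-≤-trans 0<1 1≤L) , ℬ≤memory (0≤υ small)
        where
        instance
          _ : NonZero W
          _ = W≢0
        open Width ℝ ε W (0<ε W)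

    -- Twice the excess 18 W + 2 L is 36 W + 4 L ≤ η L W + η W L as soon as
    -- 36 ≤ η L and 4 ≤ η W.
    losslessMemory-upper : ∀ η → 0# < η →
      Eventually (λ W → fromℤ (losslessMemory W) ≤ ℬ W + η * ℬ W)
    losslessMemory-upper η 0<η = eventually-map bound (eventually-∧ eventually-nonZero
      (eventually-∧ (eventually-large (⟦ + 4 ⟧ / η)) (logCells-large (⟦ + 36 ⟧ / η))))
      where
      bound : ∀ W → NonZero W × ⟦ + 4 ⟧ / η ≤ fromℕ W × ⟦ + 36 ⟧ / η ≤ logCells W →
              fromℤ (losslessMemory W) ≤ ℬ W + η * ℬ W
      bound W (W≢0 , 4/η≤w , 36/η≤L) =
        ≤-trans losslessMemory≤ (+-monoʳ-≤ (ℬ W) (*-cancelʳ-≤ 0<2 (≤-by-difference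
          (+-nonneg (*-nonneg (x≤y⇒0≤y-x (scale 36/η≤L)) (proj₁ 0<w))
                    (*-nonneg (x≤y⇒0≤y-x (scale 4/η≤w)) (0≤log₂ 1≤T)))
          (solve 3 (λ η w l → η :* (w :* l) :* con (+ 2) :- (con (+ 18) :* w :+ con (+ 2) :* l) :* con (+ 2)
                           := (l :* η :- con (+ 36)) :* w :+ (w :* η :- con (+ 4)) :* l) refl η w L))))
        where
        instance
          _ : NonZero W
          _ = W≢0
        open Width ℝ ε W (0<ε W)
        scale : ∀ {x y} → x / η ≤ y → x ≤ y * η
        scale x/η≤y = ≤-respˡ-≈ (/-cancelʳ _ 0<η) (*-monoʳ-≤ (proj₁ 0<η) x/η≤y)

    memory≤losslessMemory : Eventually (λ W → fromℤ (memory W) ≤ fromℤ (losslessMemory W))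
    memory≤losslessMemory = eventually-map
      (λ W W≢0 → Width.memory≤losslessMemory ℝ ε W {{W≢0}} (0<ε W {{W≢0}})) eventually-nonZero

    memory-asymptotics : (λ W → fromℤ (memory W)) ∼ ℬ ·[1+o1]
    memory-asymptotics = ∼-squeeze ℬ-lower λ η 0<η →
      eventually-map (λ W (le , upper) → ≤-trans le upper)
        (eventually-∧ memory≤losslessMemory (losslessMemory-upper η 0<η))

    losslessMemory-asymptotics : (λ W → fromℤ (losslessMemory W)) ∼ ℬ ·[1+o1]
    losslessMemory-asymptotics = ∼-squeeze
      (eventually-map (λ W (le , 0<ℬ , ℬ≤) → 0<ℬ , ≤-trans ℬ≤ le)
        (eventually-∧ memory≤losslessMemory ℬ-lower))
      losslessMemory-upper

theorem19 :
  ∀ {c ℓ₁ ℓ₂} (ℝ : RealField c ℓ₁ ℓ₂) →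
  let open RealField ℝ
      open Summing ℝ
  in
  (round : ℤ → Carrier → Carrier) → IsRounding round →
  (ε : ℕ → Carrier) → (∀ W → .{{_ : NonZero W}} → 0# < ε W) →
  ε =o (λ W → fromℕ W ⁻¹) →
  let open Parameters ε in
  (∀ W R → .{{_ : NonZero W}} → .{{_ : NonZero R}} →
     let open Algorithm round W R (υ W) (k W) in
     IsAdditiveApproximation W R (fromℕ R * fromℕ W * ε W) (λ xs → query (run xs)))
  × Eventually (λ W → ∀ R → .{{_ : NonZero W}} → .{{_ : NonZero R}} →
     let open Algorithm round W R (υ W) (k W) in
     ∀ xs → Fits W (run xs))
  × ((λ W → fromℤ (memory W)) ∼ ℬ ·[1+o1])
  × ((λ W → fromℤ (losslessMemory W)) ∼ ℬ ·[1+o1])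
theorem19 ℝ round isRounding ε 0<ε ε=o =
    (λ W R → Trace.additive-error ℝ round isRounding W R (υ W) (k W)
       (Width.0<κ ℝ ε W (0<ε W)) (Width.1≤κD ℝ ε W (0<ε W)))
  , (proj₁ small , λ W N≤W R → Width.fits ℝ ε W (0<ε W) (proj₂ small W N≤W) round isRounding R)
  , memory-asymptotics ε 0<ε ε=o
  , losslessMemory-asymptotics ε 0<ε ε=o
  where
  open RealField ℝ
  open Summing ℝ
  open OrderedField ℝ using (0<2)
  open Asymptotics ℝ
  open Parameters ε
  small : Eventually (λ W → 2# * (fromℕ W * ε W) ≤ 1#)
  small = Wε-small ε 0<ε ε=o 0<2
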